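{- The family of regular simple graphs which can be expressed as $\mathrm{DA}(X,S)$, for some closed, self-inverse subset $S\subseteq\mathrm{Der}(X)$, contains all of the following: (a) every finite regular simple graph of even valency; (b) every finite regular simple graph of odd valency that has a perfect matching; (c) every finite vertex-transitive simple graph, and every finite regular bipartite simple graph.
   Context: For a set $X$, $\mathrm{Sym}(X)$ is the group of all permutations of $X$, acting on the right: $x^s$ is the image of $x$ under $s$, and $x^{st}=(x^s)^t$. A derangement of $X$ is a permutation of $X$ with no fixed points; $\mathrm{Der}(X)$ is the set of derangements of $X$. For $A,B\subseteq\mathrm{Sym}(X)$, $AB=\{ab : a\in A,b\in B\}$ and $A^{ -1}=\{a^{ -1}: a\in A\}$; for $x\in X$, $x^A=\{x^a: a\in A\}$; $1$ denotes the identity permutation. A subset $S$ is self-inverse if $S=S^{ -1}$. A non-empty subset $S\subseteq\mathrm{Der}(X)$, with $X$ non-empty, is closed if both (1) $x^S=x^{S^{ -1}}$ for each $x\in X$, and (2) $SS^{ -1}\subseteq\mathrm{Der}(X)\cup\{1\}$. A simple digraph is a pair $(X,A)$ with vertex set $X$ and arc set $A\subseteq\{(u,v): u,v\in X, u\neq v\}$. It is a simple graph if $A$ is symmetric: $(x,y)\in A$ implies $(y,x)\in A$; it is then identified with the undirected graph whose edges are the pairs $\{(x,y),(y,x)\}\subseteq A$. It is regular of valency $k$ if every vertex has exactly $k$ out-neighbours and exactly $k$ in-neighbours. A perfect matching in a finite simple graph $(X,A)$ is a subgraph $(X,A')$, with $A'\subseteq A$ symmetric, each of whose connected components is a single edge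 (two vertices $u,v$ with arc set $\{(u,v),(v,u)\}$). A graph is vertex-transitive if its automorphism group is transitive on its vertices. For non-empty $X$ and non-empty $S\subseteq \mathrm{Der}(X)$, the derangement action digraph is the simple digraph with vertex set $X$ and arc set $\{(x,x^s): x\in X, s\in S\}$; when it is a simple graph it is denoted $\mathrm{DA}(X,S)$.
   Formalization: Graphs are required to have a non-empty vertex set and, in (a) and (c), at least one edge: a closed set S is non-empty by definition, so an edgeless graph (valency 0) is never of the form DA(X,S) and the literal claim fails for it. -}

module Defs where

open import Level using (0ℓ; suc)
open import Data.Bool.Base using (Bool)
open import Data.Fin.Base using (Fin)
open import Data.List.Base using (List; length)
import Data.List.Membership.Propositional as List
open import Data.List.Relation.Unary.Unique.Propositional using (Unique)
open import Data.Nat.Base using (ℕ)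
open import Data.Product using (Σ; ∃; ∃₂; _×_; _,_)
open import Data.Sum using (_⊎_)
open import Function.Bundles using (_↔_; module Inverse)
open import Function.Properties.Inverse using (↔-refl; ↔-sym; ↔-trans)
open import Relation.Binary.Construct.Closure.ReflexiveTransitive using (Star)
open import Relation.Binary.Core using (Rel; _⇒_; _⇔_)
open import Relation.Binary.Definitions using (Symmetric; Decidable; _Respects_)
open import Relation.Binary.PropositionalEquality using (_≡_; _≢_; refl; sym)
open import Relation.Unary using (Pred; _∈_; _⊆_; _≐_; _∪_; Satisfiable)

private
  variable
    X : Set

infix  10 _^_
infixl 9 _·_ _⊙_
infix  10 _⁻¹
infix  4 _≈_

Sym : Set → Set
Sym X = X ↔ X

_^_ : X → Sym X → X
x ^ s = Inverse.to s x

-- Equality of permutations is pointwise: the inverse and the proof components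
-- of a bijection are disregarded.
_≈_ : Rel (Sym X) 0ℓ
_≈_ {X} s t = (x : X) → x ^ s ≡ x ^ t

-- Right action: x ^ (s · t) is (x ^ s) ^ t.
_·_ : Sym X → Sym X → Sym X
s · t = ↔-trans s t

Der : Pred (Sym X) 0ℓ
Der {X} s = (x : X) → x ^ s ≢ x

｛1｝ : Pred (Sym X) 0ℓ
｛1｝ s = s ≈ ↔-refl

_⊙_ : Pred (Sym X) 0ℓ → Pred (Sym X) 0ℓ → Pred (Sym X) 0ℓ
(A ⊙ B) s = ∃₂ λ a b → a ∈ A × b ∈ B × s ≈ a · b

_⁻¹ : Pred (Sym X) 0ℓ → Pred (Sym X) 0ℓ
(A ⁻¹) s = ∃ λ a → a ∈ A × s ≈ ↔-sym a

orbit : X → Pred (Sym X) 0ℓ → Pred X 0ℓ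
orbit x A y = ∃ λ a → a ∈ A × x ^ a ≡ y

SelfInverse : Pred (Sym X) 0ℓ → Set
SelfInverse S = S ≐ S ⁻¹

record Closed {X : Set} (S : Pred (Sym X) 0ℓ) : Set where
  field
    -- S is a subset of Sym X, whose equality is _≈_.
    respects-≈   : S Respects _≈_
    point        : X
    nonEmpty     : Satisfiable S
    derangements : S ⊆ Der
    orbits       : (x : X) → orbit x S ≐ orbit x (S ⁻¹)
    quotients    : S ⊙ S ⁻¹ ⊆ Der ∪ ｛1｝

-- The type Arc u v may have several inhabitants; only whether it is inhabited
-- matters, and two digraphs on X are the same when their arc relations are _⇔_.
record SimpleDigraph (X : Set) : Set (suc 0ℓ) where
  field
    Arc      : Rel X 0ℓ
    loopless : ∀ {u v} → Arc u v → u ≢ v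

open SimpleDigraph public

IsSimpleGraph : SimpleDigraph X → Set
IsSimpleGraph G = Symmetric (Arc G)

-- Decidability of the arc relation is the constructive form of the arc set
-- being a subset of the finite set X × X.
FiniteDigraph : SimpleDigraph X → Set
FiniteDigraph {X} G = (∃ λ n → X ↔ Fin n) × Decidable (Arc G)

HasSize : Pred X 0ℓ → ℕ → Set
HasSize {X} P k =
  Σ (List X) λ l → Unique l × length l ≡ k × (λ x → x List.∈ l) ≐ P

RegularOfValency : ℕ → SimpleDigraph X → Set
RegularOfValency {X} k G =
  (x : X) → HasSize (λ y → Arc G x y) k × HasSize (λ y → Arc G y x) k

Regular : SimpleDigraph X → Set
Regular G = ∃ λ k → RegularOfValency k G

HasArc : SimpleDigraph X → Set
HasArc G = ∃₂ (Arc G)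

-- For symmetric R, the vertex set of the connected component of x.
Component : Rel X 0ℓ → X → Pred X 0ℓ
Component R x y = Star R x y

IsSingleEdge : Rel X 0ℓ → Pred X 0ℓ → Set
IsSingleEdge R C = ∃₂ λ u v →
    u ≢ v
  × C ≐ (λ y → y ≡ u ⊎ y ≡ v)
  × (λ y z → y ∈ C × z ∈ C × R y z)
      ⇔ (λ y z → (y ≡ u × z ≡ v) ⊎ (y ≡ v × z ≡ u))

HasPerfectMatching : SimpleDigraph X → Set₁
HasPerfectMatching {X} G = Σ (Rel X 0ℓ) λ A′ →
    A′ ⇒ Arc G
  × Symmetric A′
  × ((x : X) → IsSingleEdge A′ (Component A′ x))

IsAutomorphism : SimpleDigraph X → Pred (Sym X) 0ℓ
IsAutomorphism G π = Arc G ⇔ (λ u v → Arc G (u ^ π) (v ^ π))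

VertexTransitive : SimpleDigraph X → Set
VertexTransitive {X} G =
  (x y : X) → ∃ λ π → π ∈ IsAutomorphism G × x ^ π ≡ y

Bipartite : SimpleDigraph X → Set
Bipartite {X} G =
  Σ (X → Bool) λ part → ∀ {u v} → Arc G u v → part u ≢ part v

DA : (S : Pred (Sym X) 0ℓ) → S ⊆ Der → SimpleDigraph X
DA S S⊆Der = record
  { Arc      = λ x y → ∃ λ s → s ∈ S × x ^ s ≡ y
  ; loopless = λ { (s , s∈S , refl) x≡xˢ → S⊆Der s∈S _ (sym x≡xˢ) }
  }

-- G is a regular simple graph equal, on the same vertex set, to DA(X,S) for a
-- closed self-inverse S. As closed sets are non-empty, such a G has an arc.
record ClosedDAGraph {X : Set} (G : SimpleDigraph X) : Set (suc 0ℓ) where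
  field
    isSimpleGraph : IsSimpleGraph G
    regular       : Regular G
    S             : Pred (Sym X) 0ℓ
    closed        : Closed S
    selfInverse   : SelfInverse S
    G≡DA          : Arc G ⇔ Arc (DA S (Closed.derangements closed))

{-# OPTIONS --safe #-}
-- A finite set of permutations S is closed and self-inverse with DA(X,S) = G
-- as soon as S is closed under inversion and every arc (x , y) of G satisfies
-- x ^ s ≡ y for exactly one s ∈ S. Such sets come from factorizations.
--
-- Even valency (Petersen): the edges are oriented with equal in- and
-- out-degree k; the oriented graph, seen as a k-regular bipartite multigraph
-- on two copies of X, splits into k permutations by König's theorem; these and
-- their inverses form S. Splitting a 2d-regular bipartite multigraph into two
-- d-regular ones is again a balanced orientation, and König's theorem follows
-- by Alon's repeated halving. Odd valency: the perfect matching is one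
-- involution in S, and removing it leaves even valency. Bipartite: König's
-- permutations, each turned into an involution exchanging the parts.
--
-- Vertex-transitive of odd valency: if some maximum matching avoids a vertex,
-- then by transitivity every vertex is avoided by one, and Gallai's lemma says
-- that a maximum matching avoids at most one vertex per component. A component
-- has even order by the handshake lemma, so it cannot avoid exactly one.
module Submission where

open import Defs
open import Data.Bool.Base using (Bool; true; false; not; if_then_else_)
open import Data.Bool.Properties using (¬-not)
open import Data.Empty using (⊥; ⊥-elim)
import Data.Fin.Properties as Fin
open import Data.List.Base using (List; []; _∷_; _++_; map; length; filter; concat; concatMap; replicate; allFin)
import Data.List.Membership.DecPropositional as DecMembership
open import Data.List.Membership.Propositional using (_∈_; lose)
open import Data.List.Membership.Propositional.Properties
  using (∈-map⁺; ∈-map⁻; ∈-++⁻; ∈-++⁺ˡ; ∈-++⁺ʳ; ∈-allFin; ∈-filter⁺; ∈-filter⁻; ∈-concat⁺′)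
open import Data.List.Properties using (length-map)
open import Data.List.Relation.Binary.Permutation.Propositional using (_↭_; ↭-refl; ↭-trans; prep; swap)
import Data.List.Relation.Binary.Permutation.Propositional.Properties as Perm
open import Data.List.Relation.Unary.All as All using (All; []; _∷_)
open import Data.List.Relation.Unary.AllPairs using ([]; _∷_)
open import Data.List.Relation.Unary.Any as Any using (here; there)
open import Data.List.Relation.Unary.Unique.Propositional using (Unique)
import Data.List.Relation.Unary.Unique.Propositional.Properties as Unique
open import Data.Nat.Base using (ℕ; zero; suc; _+_; _*_; _≤_; _<_; z≤n; s≤s) renaming (_^_ to _^ᴺ_)
open import Data.Nat.DivMod using (_/_; _%_; m≡m%n+[m/n]*n; m%n<n)
open import Data.Nat.Divisibility using (_∣_; _∣?_; divides; ∣m+n∣m⇒∣n; ∣1⇒≡1)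
open import Data.Nat.GeneralisedArithmetic using (fold; fold-+)
open import Data.Nat.ListAction using (sum)
open import Data.Nat.ListAction.Properties using (sum-↭)
open import Data.Nat.Primality using (euclidsLemma; prime[2])
open import Data.Nat.Properties hiding (_≟_)
open import Algebra.Properties.CommutativeSemigroup +-commutativeSemigroup using (interchange; x∙yz≈y∙xz)
open import Data.Nat.Tactic.RingSolver using (solve-∀)
open import Data.Product using (∃; ∃₂; _×_; _,_; proj₁; proj₂)
import Data.Product.Properties as Product
open import Data.Sum using (_⊎_; inj₁; inj₂; [_,_]′)
import Data.Sum.Properties as Sum
open import Function.Base using (_∘_; id)
open import Function.Bundles using (mk↔ₛ′; module Inverse)
open import Function.Properties.Inverse using (↔-sym; ↔⇒↣)
open import Relation.Binary.Construct.Closure.ReflexiveTransitive using (Star; ε; _◅_; _◅◅_)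
open import Relation.Binary.Definitions using (DecidableEquality; Decidable; Symmetric)
open import Relation.Binary.PropositionalEquality
open import Relation.Nullary using (¬_; Dec; does; yes; no; contradiction)
open import Relation.Nullary.Decidable using (_×-dec_; ¬?; ¬¬-excluded-middle; decidable-stable; via-injection)

private
  variable
    A B P Q : Set

-- Indicators and finite sums over lists.

⟦_⟧ : Dec P → ℕ
⟦ d ⟧ = if does d then 1 else 0

⟦⟧-yes : (d : Dec P) → P → ⟦ d ⟧ ≡ 1
⟦⟧-yes (yes _) _ = refl
⟦⟧-yes (no ¬p) p = contradiction p ¬p

⟦⟧-no : (d : Dec P) → ¬ P → ⟦ d ⟧ ≡ 0
⟦⟧-no (yes p) ¬p = contradiction p ¬p
⟦⟧-no (no _) _ = refl

⟦⟧-true : (d : Dec P) → 0 < ⟦ d ⟧ → P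
⟦⟧-true (yes p) _ = p

⟦⟧-mono : (d : Dec P) (e : Dec Q) → (P → Q) → ⟦ d ⟧ ≤ ⟦ e ⟧
⟦⟧-mono (yes p) e f = ≤-reflexive (sym (⟦⟧-yes e (f p)))
⟦⟧-mono (no _) e f = z≤n

⟦⟧≤1 : (d : Dec P) → ⟦ d ⟧ ≤ 1
⟦⟧≤1 (yes _) = ≤-refl
⟦⟧≤1 (no _) = z≤n

⟦⟧-cong : (d : Dec P) (e : Dec Q) → (P → Q) → (Q → P) → ⟦ d ⟧ ≡ ⟦ e ⟧
⟦⟧-cong d e f g = ≤-antisym (⟦⟧-mono d e f) (⟦⟧-mono e d g)

⟦⟧-* : (d : Dec P) (e : Dec Q) → ⟦ d ×-dec e ⟧ ≡ ⟦ d ⟧ * ⟦ e ⟧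
⟦⟧-* (yes p) (yes q) = refl
⟦⟧-* (yes p) (no _) = refl
⟦⟧-* (no _) e = refl

∑ : List A → (A → ℕ) → ℕ
∑ l f = sum (map f l)

syntax ∑ l (λ x → e) = ∑[ x ∈ l ] e

∑-cong-∈ : ∀ (l : List A) {f g} → (∀ {x} → x ∈ l → f x ≡ g x) → ∑ l f ≡ ∑ l g
∑-cong-∈ [] eq = refl
∑-cong-∈ (x ∷ l) eq = cong₂ _+_ (eq (here refl)) (∑-cong-∈ l (eq ∘ there))

∑-cong : ∀ (l : List A) {f g} → (∀ x → f x ≡ g x) → ∑ l f ≡ ∑ l g
∑-cong l eq = ∑-cong-∈ l (λ {x} _ → eq x)

∑-mono : ∀ (l : List A) {f g} → (∀ x → f x ≤ g x) → ∑ l f ≤ ∑ l g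
∑-mono [] le = z≤n
∑-mono (x ∷ l) le = +-mono-≤ (le x) (∑-mono l le)

∑-0 : (l : List A) → ∑[ _ ∈ l ] 0 ≡ 0
∑-0 [] = refl
∑-0 (_ ∷ l) = ∑-0 l

∑-1 : (l : List A) → ∑[ _ ∈ l ] 1 ≡ length l
∑-1 [] = refl
∑-1 (_ ∷ l) = cong suc (∑-1 l)

∑-+ : ∀ (l : List A) f g → ∑[ x ∈ l ] (f x + g x) ≡ ∑ l f + ∑ l g
∑-+ [] f g = refl
∑-+ (x ∷ l) f g = trans (cong (f x + g x +_) (∑-+ l f g)) (interchange (f x) (g x) (∑ l f) (∑ l g))

∑-*ˡ : ∀ c (l : List A) f → ∑[ x ∈ l ] (c * f x) ≡ c * ∑ l f
∑-*ˡ c [] f = sym (*-zeroʳ c)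
∑-*ˡ c (x ∷ l) f = trans (cong (c * f x +_) (∑-*ˡ c l f)) (sym (*-distribˡ-+ c (f x) _))

∑-swap : ∀ (l : List A) (m : List B) (f : A → B → ℕ) → ∑[ x ∈ l ] ∑[ y ∈ m ] f x y ≡ ∑[ y ∈ m ] ∑[ x ∈ l ] f x y
∑-swap [] m f = sym (∑-0 m)
∑-swap (x ∷ l) m f = trans (cong (∑ m (f x) +_) (∑-swap l m f)) (sym (∑-+ m (f x) _))

∑-++ : ∀ (l m : List A) f → ∑ (l ++ m) f ≡ ∑ l f + ∑ m f
∑-++ [] m f = refl
∑-++ (x ∷ l) m f = trans (cong (f x +_) (∑-++ l m f)) (sym (+-assoc (f x) _ _))

∑-map : ∀ (h : A → B) l f → ∑ (map h l) f ≡ ∑ l (f ∘ h)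
∑-map h [] f = refl
∑-map h (x ∷ l) f = cong (f (h x) +_) (∑-map h l f)

∑-filter : ∀ {R : A → Set} (R? : ∀ x → Dec (R x)) l f → ∑ (filter R? l) f ≡ ∑[ x ∈ l ] (⟦ R? x ⟧ * f x)
∑-filter R? [] f = refl
∑-filter R? (x ∷ l) f with R? x
... | yes _ = cong₂ _+_ (sym (+-identityʳ (f x))) (∑-filter R? l f)
... | no _ = ∑-filter R? l f

∑-replicate : ∀ n (l : List A) f → ∑ (concat (replicate n l)) f ≡ n * ∑ l f
∑-replicate zero l f = refl
∑-replicate (suc n) l f = trans (∑-++ l _ f) (cong (∑ l f +_) (∑-replicate n l f))

∑-↭ : ∀ {l m : List A} f → l ↭ m → ∑ l f ≡ ∑ m f
∑-↭ f p = sum-↭ (Perm.map⁺ f p)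

∑-∈ : ∀ {l : List A} {x} f → x ∈ l → f x ≤ ∑ l f
∑-∈ f (here refl) = m≤m+n _ _
∑-∈ {l = y ∷ l} f (there x∈l) = ≤-trans (∑-∈ f x∈l) (m≤n+m _ (f y))

-- The alternatives compare the positions of the two memberships rather than the elements, which may
-- be permutations without decidable equality. Entries at different positions contribute separately
-- to the sum, even when they are equal.
∑-pair : ∀ {l : List A} {x y} → x ∈ l → y ∈ l → x ≡ y ⊎ (∀ f → f x + f y ≤ ∑ l f)
∑-pair (here refl) (here refl) = inj₁ refl
∑-pair (here refl) (there y∈l) = inj₂ λ f → +-monoʳ-≤ _ (∑-∈ f y∈l)
∑-pair {x = x} {y} (there x∈l) (here refl) =
  inj₂ λ f → ≤-trans (≤-reflexive (+-comm (f x) (f y))) (+-monoʳ-≤ _ (∑-∈ f x∈l))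
∑-pair {l = z ∷ l} (there x∈l) (there y∈l) with ∑-pair x∈l y∈l
... | inj₁ eq = inj₁ eq
... | inj₂ le = inj₂ λ f → ≤-trans (le f) (m≤n+m _ (f z))

extract : ∀ {l : List A} {x} → x ∈ l → ∃ λ r → l ↭ x ∷ r
extract (here refl) = _ , ↭-refl
extract {l = y ∷ l} (there x∈l) = let r , p = extract x∈l in
  y ∷ r , ↭-trans (prep y p) (swap y _ ↭-refl)

∑-positive : ∀ (l : List A) {f} → 0 < ∑ l f → ∃ λ x → x ∈ l × 0 < f x
∑-positive (x ∷ l) {f} pos with f x in eq
... | suc n = x , here refl , subst (0 <_) (sym eq) (s≤s z≤n)
... | zero = let y , y∈l , fy = ∑-positive l pos in y , there y∈l , fy

Unique-count : (_≟_ : DecidableEquality A) {l : List A} {x : A} → Unique l → x ∈ l → ∑[ y ∈ l ] ⟦ y ≟ x ⟧ ≡ 1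
Unique-count _≟_ {l = _ ∷ l} {x} (y∉l ∷ _) (here refl) = cong₂ _+_ (⟦⟧-yes (x ≟ x) refl)
  (trans (∑-cong-∈ l λ {z} z∈l → ⟦⟧-no (z ≟ x) (All.lookup y∉l z∈l ∘ sym)) (∑-0 l))
Unique-count _≟_ {x = x} (_∷_ {x = y} y∉l u) (there x∈l) =
  cong₂ _+_ (⟦⟧-no (y ≟ x) (All.lookup y∉l x∈l)) (Unique-count _≟_ u x∈l)

∑≤1-injective : ∀ (l : List A) {f x y} → ∑ l f ≤ 1 → x ∈ l → y ∈ l → 0 < f x → 0 < f y → x ≡ y
∑≤1-injective l {f} le x∈l y∈l fx fy with ∑-pair x∈l y∈l
... | inj₁ eq = eq
... | inj₂ pair = contradiction (≤-trans (+-mono-≤ fx fy) (≤-trans (pair f) le)) λ { (s≤s ()) }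

-- Balanced orientations of multigraphs.

-- A multigraph is a list of edges; an orientation of E is a list of edges
-- giving every symmetric weight the same sum as E.

Symmetric₂ : (A × A → ℕ) → Set
Symmetric₂ {A} f = (x y : A) → f (x , y) ≡ f (y , x)

module Multigraph {V : Set} (_≟_ : DecidableEquality V) where

  _≟₂_ : DecidableEquality (V × V)
  _≟₂_ = Product.≡-dec _≟_ _≟_

  out in′ degree : List (V × V) → V → ℕ
  out E x = ∑[ e ∈ E ] ⟦ proj₁ e ≟ x ⟧
  in′ E x = ∑[ e ∈ E ] ⟦ proj₂ e ≟ x ⟧
  degree E x = ∑[ e ∈ E ] (⟦ proj₁ e ≟ x ⟧ + ⟦ proj₂ e ≟ x ⟧)

  Orients : List (V × V) → List (V × V) → Set
  Orients D E = ∀ f → Symmetric₂ f → ∑ D f ≡ ∑ E f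

  Balanced : List (V × V) → Set
  Balanced D = ∀ x → out D x ≡ in′ D x

  isEdge : V → V → V × V → ℕ
  isEdge u w e = ⟦ e ≟₂ (u , w) ⟧ + ⟦ e ≟₂ (w , u) ⟧

  isEdge-symmetric : ∀ u w → Symmetric₂ (isEdge u w)
  isEdge-symmetric u w a b = trans (+-comm ⟦ (a , b) ≟₂ (u , w) ⟧ _) (cong₂ _+_
    (⟦⟧-cong ((a , b) ≟₂ (w , u)) ((b , a) ≟₂ (u , w)) (λ { refl → refl }) (λ { refl → refl }))
    (⟦⟧-cong ((a , b) ≟₂ (u , w)) ((b , a) ≟₂ (w , u)) (λ { refl → refl }) (λ { refl → refl })))

  degree-out+in : ∀ E x → degree E x ≡ out E x + in′ E x
  degree-out+in E x = ∑-+ E _ _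

  degree-symmetric : ∀ x → Symmetric₂ (λ e → ⟦ proj₁ e ≟ x ⟧ + ⟦ proj₂ e ≟ x ⟧)
  degree-symmetric x a b = +-comm ⟦ a ≟ x ⟧ ⟦ b ≟ x ⟧

  private
    -- The edge `(u , v)` contributes exactly 1 to the even degree of `v`, so `E` has a further edge
    -- at `v`. It may be listed as `(w , v)`, hence the conclusion in terms of symmetric weights.
    another-edge : ∀ u v E → u ≢ v → 2 ∣ degree ((u , v) ∷ E) v →
      ∃₂ λ w R → length E ≡ suc (length R) × (∀ f → Symmetric₂ f → ∑ E f ≡ f (v , w) + ∑ R f)
    another-edge u v E u≢v even with ∑-positive E positive
      where
      positive : 0 < degree E v
      positive = n≢0⇒n>0 λ eq → contradiction (∣1⇒≡1 (subst (2 ∣_) (degree≡1 eq) even)) λ ()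
        where
        degree≡1 : degree E v ≡ 0 → degree ((u , v) ∷ E) v ≡ 1
        degree≡1 eq = cong₂ _+_ (cong₂ _+_ (⟦⟧-no (u ≟ v) u≢v) (⟦⟧-yes (v ≟ v) refl)) eq
    ... | (a , b) , e∈E , pos with extract e∈E | a ≟ v | b ≟ v
    ... | R , p | yes refl | _ = b , R , Perm.↭-length p , λ f _ → ∑-↭ f p
    ... | R , p | no _ | yes refl = a , R , Perm.↭-length p ,
      λ f f-sym → trans (∑-↭ f p) (cong (_+ ∑ R f) (f-sym a v))

    -- Subdividing `(s , t)` at `v` raises the in-degree and the out-degree of `v` by one each.
    detour : ∀ {D D′} s v t → D ↭ (s , t) ∷ D′ → Balanced D → Balanced ((s , v) ∷ (v , t) ∷ D′)
    detour {D} {D′} s v t p balanced x = begin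
      ⟦ s ≟ x ⟧ + (⟦ v ≟ x ⟧ + out D′ x)  ≡⟨ x∙yz≈y∙xz ⟦ s ≟ x ⟧ ⟦ v ≟ x ⟧ (out D′ x) ⟩
      ⟦ v ≟ x ⟧ + (⟦ s ≟ x ⟧ + out D′ x)  ≡⟨ cong (⟦ v ≟ x ⟧ +_) (∑-↭ _ p) ⟨
      ⟦ v ≟ x ⟧ + out D x                 ≡⟨ cong (⟦ v ≟ x ⟧ +_) (balanced x) ⟩
      ⟦ v ≟ x ⟧ + in′ D x                 ≡⟨ cong (⟦ v ≟ x ⟧ +_) (∑-↭ _ p) ⟩
      ⟦ v ≟ x ⟧ + (⟦ t ≟ x ⟧ + in′ D′ x)  ∎
      where open ≡-Reasoning

    -- The weight `isEdge u w` is symmetric and positive on `(u , w)`, so its sum over `D` is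
    -- positive as well, and `D` contains the edge in one of its two directions.
    find-edge : ∀ D E u w → Orients D ((u , w) ∷ E) →
      ∃ λ D′ → (D ↭ (u , w) ∷ D′ ⊎ D ↭ (w , u) ∷ D′) × Orients D′ E
    find-edge D E u w orients with ∑-positive D positive
      where
      positive : 0 < ∑ D (isEdge u w)
      positive = begin
        1                       ≡⟨ ⟦⟧-yes ((u , w) ≟₂ (u , w)) refl ⟨
        ⟦ (u , w) ≟₂ (u , w) ⟧  ≤⟨ m≤m+n _ _ ⟩
        isEdge u w (u , w)          ≤⟨ m≤m+n _ _ ⟩
        ∑ ((u , w) ∷ E) (isEdge u w)  ≡⟨ orients (isEdge u w) (isEdge-symmetric u w) ⟨
        ∑ D (isEdge u w)              ∎
        where open ≤-Reasoning
    ... | e , e∈D , pos with extract e∈D | e ≟₂ (u , w) | e ≟₂ (w , u)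
    ... | D′ , p | yes refl | _ = D′ , inj₁ p ,
      λ f f-sym → +-cancelˡ-≡ (f (u , w)) _ _ (trans (sym (∑-↭ f p)) (orients f f-sym))
    ... | D′ , p | no _ | yes refl = D′ , inj₂ p ,
      λ f f-sym → +-cancelˡ-≡ (f (w , u)) _ _
        (trans (sym (∑-↭ f p)) (trans (orients f f-sym) (cong (_+ ∑ E f) (f-sym u w))))

  -- Two edges u–v–w are replaced by the single edge u–w, whose orientation
  -- then dictates that of the path through v.
  balanced-orientation : ∀ n E → length E ≡ n → (∀ x → 2 ∣ degree E x) → ∃ λ D → Balanced D × Orients D E
  balanced-orientation _ [] _ _ = [] , (λ _ → refl) , λ _ _ → refl
  balanced-orientation (suc n) ((u , v) ∷ E) eq even with u ≟ v
  ... | yes refl =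
    let D , balanced , orients = balanced-orientation n E (suc-injective eq)
          λ x → ∣m+n∣m⇒∣n (even x) (divides ⟦ u ≟ x ⟧ (double ⟦ u ≟ x ⟧))
    in (u , u) ∷ D , (λ x → cong (⟦ u ≟ x ⟧ +_) (balanced x)) , λ f f-sym → cong (f (u , u) +_) (orients f f-sym)
    where
    double : ∀ a → a + a ≡ a * 2
    double = solve-∀
  ... | no u≢v =
    -- Trading `(u , v)` and `(v , w)` for `(u , w)` lowers the number of edges by one, which makes
    -- the recursion on the length terminate, and lowers only the degree of `v`, by two.
    let w , R , len , split = another-edge u v E u≢v (even v)
        D , balanced , orients = balanced-orientation n ((u , w) ∷ R) (trans (sym len) (suc-injective eq))
          λ x → ∣m+n∣m⇒∣n (subst (2 ∣_) (shortcut w R split x) (even x)) (divides ⟦ v ≟ x ⟧ refl)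
        D′ , edge , orients′ = find-edge D R u w orients
        orients″ : ∀ f → Symmetric₂ f → f (u , v) + (f (v , w) + ∑ D′ f) ≡ f (u , v) + ∑ E f
        orients″ f f-sym = cong (f (u , v) +_) (trans (cong (f (v , w) +_) (orients′ f f-sym)) (sym (split f f-sym)))
    in case-edge edge balanced orients″
    where
    rearrange : ∀ a b c d → a + b + (b + c + d) ≡ b * 2 + (a + c + d)
    rearrange = solve-∀

    shortcut : ∀ w R → (∀ f → Symmetric₂ f → ∑ E f ≡ f (v , w) + ∑ R f) →
      ∀ x → degree ((u , v) ∷ E) x ≡ ⟦ v ≟ x ⟧ * 2 + degree ((u , w) ∷ R) x
    shortcut w R split x = trans (cong (⟦ u ≟ x ⟧ + ⟦ v ≟ x ⟧ +_) (split _ (degree-symmetric x)))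
      (rearrange ⟦ u ≟ x ⟧ ⟦ v ≟ x ⟧ ⟦ w ≟ x ⟧ (degree R x))

    case-edge : ∀ {w D D′} → D ↭ (u , w) ∷ D′ ⊎ D ↭ (w , u) ∷ D′ → Balanced D →
      (∀ f → Symmetric₂ f → f (u , v) + (f (v , w) + ∑ D′ f) ≡ f (u , v) + ∑ E f) →
      ∃ λ D → Balanced D × Orients D ((u , v) ∷ E)
    case-edge {w} {D′ = D′} (inj₁ p) balanced orients = (u , v) ∷ (v , w) ∷ D′ , detour u v w p balanced , orients
    case-edge {w} {D′ = D′} (inj₂ p) balanced orients = (w , v) ∷ (v , u) ∷ D′ , detour w v u p balanced ,
      λ f f-sym → trans (x∙yz≈y∙xz (f (w , v)) (f (v , u)) (∑ D′ f))
        (trans (cong₂ (λ a b → a + (b + ∑ D′ f)) (f-sym v u) (f-sym w v)) (orients f f-sym))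

-- König's theorem for regular bipartite multigraphs.

n<2^n : ∀ n → n < 2 ^ᴺ n
n<2^n zero = s≤s z≤n
n<2^n (suc n) = +-mono-≤ (≤-trans (s≤s z≤n) (n<2^n n)) (≤-trans (n<2^n n) (m≤m+n _ 0))

sublist-complement : ∀ {P E : List A} → Unique P → (∀ {e} → e ∈ P → e ∈ E) → ∃ λ R → E ↭ P ++ R
sublist-complement {P = []} {E} _ _ = E , ↭-refl
sublist-complement {P = e ∷ P} {E} (e∉P ∷ u) P⊆E =
  let E′ , p = extract (P⊆E (here refl))
      R , q = sublist-complement u λ {e′} e′∈P → tail-∈ (All.lookup e∉P e′∈P) (Perm.∈-resp-↭ p (P⊆E (there e′∈P)))
  in R , ↭-trans p (prep e q)
  where
  tail-∈ : ∀ {E′ e′} → e ≢ e′ → e′ ∈ e ∷ E′ → e′ ∈ E′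
  tail-∈ e≢e′ (here refl) = contradiction refl e≢e′
  tail-∈ _ (there e′∈E′) = e′∈E′

module OneFactorization {X : Set} (_≟_ : DecidableEquality X)
  (vs : List X) (vs-unique : Unique vs) (vs-complete : ∀ x → x ∈ vs) where

  open Multigraph _≟_ using (_≟₂_; out; in′)

  -- An edge (x , y) joins x in the first copy of X to y in the second.
  Biregular : ℕ → List (X × X) → Set
  Biregular d E = ∀ x → out E x ≡ d × in′ E x ≡ d

  multiplicity : List (X × X) → X → X → ℕ
  multiplicity E x y = ∑[ e ∈ E ] ⟦ e ≟₂ (x , y) ⟧

  multiplicity≤out : ∀ E x y → multiplicity E x y ≤ out E x
  multiplicity≤out E x y = ∑-mono E λ e → ⟦⟧-mono (e ≟₂ (x , y)) (proj₁ e ≟ x) λ { refl → refl }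

  private
    module Double = Multigraph (Sum.≡-dec _≟_ _≟_)

    forward backward : X × X → (X ⊎ X) × (X ⊎ X)
    forward e = inj₁ (proj₁ e) , inj₂ (proj₂ e)
    backward e = inj₂ (proj₂ e) , inj₁ (proj₁ e)

    -- A symmetric weight, so that its sum is unchanged by orienting; the sum vanishes exactly when
    -- every edge joins the two copies.
    sameSide : (X ⊎ X) × (X ⊎ X) → ℕ
    sameSide (inj₁ _ , inj₁ _) = 1
    sameSide (inj₁ _ , inj₂ _) = 0
    sameSide (inj₂ _ , inj₁ _) = 0
    sameSide (inj₂ _ , inj₂ _) = 1

    sameSide-symmetric : Symmetric₂ sameSide
    sameSide-symmetric (inj₁ _) (inj₁ _) = refl
    sameSide-symmetric (inj₁ _) (inj₂ _) = refl
    sameSide-symmetric (inj₂ _) (inj₁ _) = refl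
    sameSide-symmetric (inj₂ _) (inj₂ _) = refl

    -- Extends a weight on bipartite edges to both directions, which makes it comparable along an
    -- orientation.
    undirected : (X × X → ℕ) → (X ⊎ X) × (X ⊎ X) → ℕ
    undirected f (inj₁ x , inj₂ y) = f (x , y)
    undirected f (inj₂ y , inj₁ x) = f (x , y)
    undirected f (inj₁ _ , inj₁ _) = 0
    undirected f (inj₂ _ , inj₂ _) = 0

    undirected-symmetric : ∀ f → Symmetric₂ (undirected f)
    undirected-symmetric f (inj₁ _) (inj₁ _) = refl
    undirected-symmetric f (inj₁ _) (inj₂ _) = refl
    undirected-symmetric f (inj₂ _) (inj₁ _) = refl
    undirected-symmetric f (inj₂ _) (inj₂ _) = refl

    separate : ∀ D → ∑ D sameSide ≡ 0 →
      ∃₂ λ D₁ D₂ → ∀ g → ∑ D g ≡ ∑ D₁ (g ∘ forward) + ∑ D₂ (g ∘ backward)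
    separate [] _ = [] , [] , λ _ → refl
    separate ((inj₁ x , inj₂ y) ∷ D) cross = let D₁ , D₂ , eq = separate D cross in
      (x , y) ∷ D₁ , D₂ , λ g → trans (cong (g (inj₁ x , inj₂ y) +_) (eq g)) (sym (+-assoc (g (inj₁ x , inj₂ y)) _ _))
    separate ((inj₂ y , inj₁ x) ∷ D) cross = let D₁ , D₂ , eq = separate D cross in
      D₁ , (x , y) ∷ D₂ , λ g → trans (cong (g (inj₂ y , inj₁ x) +_) (eq g))
        (x∙yz≈y∙xz (g (inj₂ y , inj₁ x)) (∑ D₁ (g ∘ forward)) (∑ D₂ (g ∘ backward)))

    halves : ∀ {a b d} → a ≡ b → 2 * d ≡ a + b → a ≡ d × b ≡ d
    halves {a} {d = d} refl eq = a≡d , a≡d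
      where
      a≡d : a ≡ d
      a≡d = *-cancelˡ-≡ a d 2 (trans (cong (a +_) (+-identityʳ a)) (sym eq))

  -- In a balanced orientation, `D₁` collects the edges directed from the first copy to the second
  -- and `D₂` those directed back. Balance at a vertex of either copy says that its degrees in `D₁`
  -- and `D₂` agree.
  halve : ∀ d E → Biregular (2 * d) E →
    ∃₂ λ D₁ D₂ → Biregular d D₁ × Biregular d D₂ × (∀ f → ∑ E f ≡ ∑ D₁ f + ∑ D₂ f)
  halve d E regular = D₁ , D₂ , (λ x → proj₁ (out-halves x) , proj₁ (in-halves x)) ,
    (λ x → proj₂ (out-halves x) , proj₂ (in-halves x)) , sum-halves
    where
    even : ∀ x → 2 ∣ Double.degree (map forward E) x
    even (inj₁ x) = divides d (trans (trans (∑-map forward E _) (∑-cong E λ e → +-identityʳ _))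
      (trans (proj₁ (regular x)) (*-comm 2 d)))
    even (inj₂ x) = divides d (trans (∑-map forward E _) (trans (proj₂ (regular x)) (*-comm 2 d)))

    orientation : ∃ λ D → Double.Balanced D × Double.Orients D (map forward E)
    orientation = Double.balanced-orientation _ (map forward E) refl even

    D = proj₁ orientation
    balanced = proj₁ (proj₂ orientation)
    orients = proj₂ (proj₂ orientation)

    separated : ∃₂ λ D₁ D₂ → ∀ g → ∑ D g ≡ ∑ D₁ (g ∘ forward) + ∑ D₂ (g ∘ backward)
    separated = separate D (trans (orients _ sameSide-symmetric) (trans (∑-map forward E _) (∑-0 E)))

    D₁ = proj₁ separated
    D₂ = proj₁ (proj₂ separated)

    sum-halves : ∀ f → ∑ E f ≡ ∑ D₁ f + ∑ D₂ f
    sum-halves f = trans (sym (∑-map forward E (undirected f)))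
      (trans (sym (orients _ (undirected-symmetric f))) (proj₂ (proj₂ separated) (undirected f)))

    out≡ : ∀ x → out D₁ x ≡ out D₂ x
    out≡ x = begin
      out D₁ x                      ≡⟨ +-identityʳ _ ⟨
      out D₁ x + 0                  ≡⟨ cong (out D₁ x +_) (∑-0 D₂) ⟨
      out D₁ x + ∑[ _ ∈ D₂ ] 0      ≡⟨ proj₂ (proj₂ separated) _ ⟨
      Double.out D (inj₁ x)         ≡⟨ balanced (inj₁ x) ⟩
      Double.in′ D (inj₁ x)         ≡⟨ proj₂ (proj₂ separated) _ ⟩
      ∑[ _ ∈ D₁ ] 0 + out D₂ x      ≡⟨ cong (_+ out D₂ x) (∑-0 D₁) ⟩
      out D₂ x                      ∎
      where open ≡-Reasoning

    in≡ : ∀ x → in′ D₁ x ≡ in′ D₂ x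
    in≡ x = begin
      in′ D₁ x                      ≡⟨ +-identityʳ _ ⟨
      in′ D₁ x + 0                  ≡⟨ cong (in′ D₁ x +_) (∑-0 D₂) ⟨
      in′ D₁ x + ∑[ _ ∈ D₂ ] 0      ≡⟨ proj₂ (proj₂ separated) _ ⟨
      Double.in′ D (inj₂ x)         ≡⟨ balanced (inj₂ x) ⟨
      Double.out D (inj₂ x)         ≡⟨ proj₂ (proj₂ separated) _ ⟩
      ∑[ _ ∈ D₁ ] 0 + in′ D₂ x      ≡⟨ cong (_+ in′ D₂ x) (∑-0 D₁) ⟩
      in′ D₂ x                      ∎
      where open ≡-Reasoning

    out-halves : ∀ x → out D₁ x ≡ d × out D₂ x ≡ d
    out-halves x = halves (out≡ x) (trans (sym (proj₁ (regular x))) (sum-halves _))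

    in-halves : ∀ x → in′ D₁ x ≡ d × in′ D₂ x ≡ d
    in-halves x = halves (in≡ x) (trans (sym (proj₂ (regular x))) (sum-halves _))

  -- If the total weight is below `2 * 2 ^ᴺ t`, one of the two halves has weight below `2 ^ᴺ t`.
  -- After the last halving the weight is below 1.
  repeated-halving : ∀ t E bad → Biregular (2 ^ᴺ t) E → ∑ E bad < 2 ^ᴺ t → ∃ λ P → Biregular 1 P × ∑ P bad ≡ 0
  repeated-halving zero E bad regular few = E , regular , n<1⇒n≡0 few
  repeated-halving (suc t) E bad regular few with halve (2 ^ᴺ t) E regular
  ... | D₁ , D₂ , regular₁ , regular₂ , split with ∑ D₁ bad <? 2 ^ᴺ t
  ... | yes few₁ = repeated-halving t D₁ bad regular₁ few₁
  ... | no many₁ = repeated-halving t D₂ bad regular₂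
    (+-cancelˡ-< (2 ^ᴺ t) _ _ (begin-strict
      2 ^ᴺ t + ∑ D₂ bad           ≤⟨ +-monoˡ-≤ _ (≮⇒≥ many₁) ⟩
      ∑ D₁ bad + ∑ D₂ bad         ≡⟨ split bad ⟨
      ∑ E bad                     <⟨ few ⟩
      2 ^ᴺ t + (2 ^ᴺ t + 0)       ≡⟨ cong (2 ^ᴺ t +_) (+-identityʳ _) ⟩
      2 ^ᴺ t + 2 ^ᴺ t             ∎))
    where open ≤-Reasoning

  -- Alon's proof of König's theorem: α copies of E and β < d loops at each
  -- vertex form a 2ᵗ-regular multigraph, and halving it t times while keeping
  -- the half with fewer new edges gets rid of all new edges.
  one-factor : ∀ k E → Biregular (suc k) E → ∃ λ P → Biregular 1 P × (∀ {e} → e ∈ P → e ∈ E)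
  one-factor k E regular =
    let P , regular-P , good = repeated-halving t padded bad padded-regular few in
    P , regular-P , λ {e} e∈P → good⇒∈ e (n≤0⇒n≡0 (subst (bad e ≤_) good (∑-∈ bad e∈P)))
    where
    d = suc k
    -- The total bad weight is at most `β * length vs`, hence at most `d * length vs`; this choice
    -- of `t` puts it below `2 ^ᴺ t` by `n<2^n`.
    t = d * length vs
    α = 2 ^ᴺ t / d
    β = 2 ^ᴺ t % d

    _∈?_ : ∀ e F → Dec (e ∈ F)
    _∈?_ = DecMembership._∈?_ _≟₂_

    -- A padding loop that happens to be an edge of `E` does no harm and is not counted.
    bad : X × X → ℕ
    bad e = ⟦ ¬? (e ∈? E) ⟧

    good⇒∈ : ∀ e → bad e ≡ 0 → e ∈ E
    good⇒∈ e eq with e ∈? E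
    ... | yes e∈E = e∈E

    loops padded : List (X × X)
    loops = map (λ x → x , x) vs
    padded = concat (replicate α E) ++ concat (replicate β loops)

    ∑-padded : ∀ f → ∑ padded f ≡ α * ∑ E f + β * ∑[ x ∈ vs ] f (x , x)
    ∑-padded f = trans (∑-++ (concat (replicate α E)) _ f)
      (cong₂ _+_ (∑-replicate α E f) (trans (∑-replicate β loops f) (cong (β *_) (∑-map _ vs f))))

    degree : ∀ {a b} → a ≡ d → b ≡ 1 → α * a + β * b ≡ 2 ^ᴺ t
    degree refl refl = trans (cong (α * d +_) (*-identityʳ β)) (trans (+-comm (α * d) β) (sym (m≡m%n+[m/n]*n (2 ^ᴺ t) d)))

    padded-regular : Biregular (2 ^ᴺ t) padded
    padded-regular x =
      trans (∑-padded _) (degree (proj₁ (regular x)) (Unique-count _≟_ vs-unique (vs-complete x))) ,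
      trans (∑-padded _) (degree (proj₂ (regular x)) (Unique-count _≟_ vs-unique (vs-complete x)))

    few : ∑ padded bad < 2 ^ᴺ t
    few = begin-strict
      ∑ padded bad                                  ≡⟨ ∑-padded bad ⟩
      α * ∑ E bad + β * ∑[ x ∈ vs ] bad (x , x)     ≡⟨ cong (λ z → α * z + β * ∑[ x ∈ vs ] bad (x , x)) E-good ⟩
      α * 0 + β * ∑[ x ∈ vs ] bad (x , x)           ≡⟨ cong (_+ β * ∑[ x ∈ vs ] bad (x , x)) (*-zeroʳ α) ⟩
      β * ∑[ x ∈ vs ] bad (x , x)                   ≤⟨ *-monoʳ-≤ β (∑-mono vs λ x → ⟦⟧≤1 (¬? ((x , x) ∈? E))) ⟩
      β * ∑[ x ∈ vs ] 1                             ≡⟨ cong (β *_) (∑-1 vs) ⟩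
      β * length vs                                 ≤⟨ *-monoˡ-≤ (length vs) (<⇒≤ (m%n<n (2 ^ᴺ t) d)) ⟩
      t                                             <⟨ n<2^n t ⟩
      2 ^ᴺ t                                        ∎
      where
      open ≤-Reasoning
      E-good : ∑ E bad ≡ 0
      E-good = trans (∑-cong-∈ E λ {e} e∈E → ⟦⟧-no (¬? (e ∈? E)) (λ e∉E → e∉E e∈E)) (∑-0 E)

  out≤1⇒Unique : ∀ P → (∀ x → out P x ≤ 1) → Unique P
  out≤1⇒Unique [] _ = []
  out≤1⇒Unique (e ∷ P) le =
    All.tabulate (λ {e′} e′∈P e≡e′ → contradiction (begin
      1 + 1                                            ≡⟨ cong₂ _+_ (⟦⟧-yes (proj₁ e ≟ proj₁ e) refl)
                                                            (⟦⟧-yes (proj₁ e′ ≟ proj₁ e) (cong proj₁ (sym e≡e′))) ⟨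
      ⟦ proj₁ e ≟ proj₁ e ⟧ + ⟦ proj₁ e′ ≟ proj₁ e ⟧    ≤⟨ +-monoʳ-≤ _ (∑-∈ _ e′∈P) ⟩
      out (e ∷ P) (proj₁ e)                            ≤⟨ le (proj₁ e) ⟩
      1                                                ∎) λ { (s≤s ()) })
    ∷ out≤1⇒Unique P λ x → ≤-trans (m≤n+m _ _) (le x)
    where open ≤-Reasoning

  permutation : ∀ P → Biregular 1 P → ∃ λ (π : Sym X) → ∀ x y → multiplicity P x y ≡ ⟦ (x ^ π) ≟ y ⟧
  permutation P regular = mk↔ₛ′ to from to∘from from∘to , multiplicity≡
    where
    edge-from : ∀ x → ∃ λ y → (x , y) ∈ P
    edge-from x with ∑-positive P (subst (0 <_) (sym (proj₁ (regular x))) (s≤s z≤n))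
    ... | (a , b) , e∈P , pos with a ≟ x
    ... | yes refl = b , e∈P

    edge-to : ∀ y → ∃ λ x → (x , y) ∈ P
    edge-to y with ∑-positive P (subst (0 <_) (sym (proj₂ (regular y))) (s≤s z≤n))
    ... | (a , b) , e∈P , pos with b ≟ y
    ... | yes refl = a , e∈P

    functional : ∀ {x y y′} → (x , y) ∈ P → (x , y′) ∈ P → y ≡ y′
    functional {x} p q = cong proj₂ (∑≤1-injective P (≤-reflexive (proj₁ (regular x))) p q x≡x x≡x)
      where
      x≡x = ≤-reflexive (sym (⟦⟧-yes (x ≟ x) refl))

    injective : ∀ {x x′ y} → (x , y) ∈ P → (x′ , y) ∈ P → x ≡ x′
    injective {y = y} p q = cong proj₁ (∑≤1-injective P (≤-reflexive (proj₂ (regular y))) p q y≡y y≡y)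
      where
      y≡y = ≤-reflexive (sym (⟦⟧-yes (y ≟ y) refl))

    to from : X → X
    to x = proj₁ (edge-from x)
    from y = proj₁ (edge-to y)

    to∘from : ∀ y → to (from y) ≡ y
    to∘from y = functional (proj₂ (edge-from (from y))) (proj₂ (edge-to y))

    from∘to : ∀ x → from (to x) ≡ x
    from∘to x = injective (proj₂ (edge-to (to x))) (proj₂ (edge-from x))

    multiplicity≡ : ∀ x y → multiplicity P x y ≡ ⟦ to x ≟ y ⟧
    multiplicity≡ x y with to x ≟ y
    ... | yes refl = ≤-antisym (≤-trans (multiplicity≤out P x y) (≤-reflexive (proj₁ (regular x))))
      (≤-trans (≤-reflexive (sym (⟦⟧-yes ((x , y) ≟₂ (x , y)) refl))) (∑-∈ _ (proj₂ (edge-from x))))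
    ... | no to[x]≢y = n≤0⇒n≡0 (≮⇒≥ λ pos →
      let e , e∈P , e≡xy = ∑-positive P pos in
      to[x]≢y (functional (proj₂ (edge-from x)) (subst (_∈ P) (⟦⟧-true (e ≟₂ (x , y)) e≡xy) e∈P)))

  -- One-factors are peeled off one at a time. The edges of a one-factor are distinct, so it can be
  -- removed from `E` as a sublist, and the rest is regular of degree one less.
  one-factorization : ∀ k E → Biregular k E →
    ∃ λ (πs : List (Sym X)) → ∀ x y → multiplicity E x y ≡ ∑[ π ∈ πs ] ⟦ (x ^ π) ≟ y ⟧
  one-factorization zero E regular =
    [] , λ x y → n≤0⇒n≡0 (≤-trans (multiplicity≤out E x y) (≤-reflexive (proj₁ (regular x))))
  one-factorization (suc k) E regular =
    let P , regular-P , P⊆E = one-factor k E regular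
        R , E↭P++R = sublist-complement (out≤1⇒Unique P λ x → ≤-reflexive (proj₁ (regular-P x))) P⊆E
        split = λ f → trans (∑-↭ f E↭P++R) (∑-++ P R f)
        π , π≡ = permutation P regular-P
        πs , πs≡ = one-factorization k R λ x →
          rest (split _) (proj₁ (regular x)) (proj₁ (regular-P x)) ,
          rest (split _) (proj₂ (regular x)) (proj₂ (regular-P x))
    in π ∷ πs , λ x y → trans (split _) (cong₂ _+_ (π≡ x y) (πs≡ x y))
    where
    rest : ∀ {a b c} → a ≡ b + c → a ≡ suc k → b ≡ 1 → c ≡ k
    rest refl eq refl = suc-injective eq

-- Double counting of arcs and edges in a finite graph.

∑-concat : ∀ (l : List A) (h : A → List B) f → ∑ (concat (map h l)) f ≡ ∑[ x ∈ l ] ∑ (h x) f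
∑-concat [] h f = refl
∑-concat (x ∷ l) h f = trans (∑-++ (h x) _ f) (cong (∑ (h x) f +_) (∑-concat l h f))

pairs : List A → List (A × A)
pairs [] = []
pairs (x ∷ l) = map (x ,_) l ++ pairs l

-- The square of the list consists of its diagonal and two triangles, which the symmetry of `f`
-- identifies.
∑∑-symmetric : ∀ (l : List A) f → Symmetric₂ f →
  ∑[ x ∈ l ] ∑[ y ∈ l ] f (x , y) ≡ 2 * ∑ (pairs l) f + ∑[ x ∈ l ] f (x , x)
∑∑-symmetric [] f f-sym = refl
∑∑-symmetric (a ∷ l) f f-sym = begin
  f (a , a) + s + ∑[ x ∈ l ] (f (x , a) + ∑[ y ∈ l ] f (x , y))
    ≡⟨ cong (f (a , a) + s +_) (∑-+ l _ _) ⟩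
  f (a , a) + s + (∑[ x ∈ l ] f (x , a) + ∑[ x ∈ l ] ∑[ y ∈ l ] f (x , y))
    ≡⟨ cong (f (a , a) + s +_) (cong₂ _+_ (∑-cong l λ x → f-sym x a) (∑∑-symmetric l f f-sym)) ⟩
  f (a , a) + s + (s + (2 * ∑ (pairs l) f + diagonal))
    ≡⟨ rearrange (f (a , a)) s (∑ (pairs l) f) diagonal ⟩
  2 * (s + ∑ (pairs l) f) + (f (a , a) + diagonal)
    ≡⟨ cong (λ z → 2 * z + (f (a , a) + diagonal)) (cong (_+ ∑ (pairs l) f) (∑-map (a ,_) l f)) ⟨
  2 * (∑ (map (a ,_) l) f + ∑ (pairs l) f) + (f (a , a) + diagonal)
    ≡⟨ cong (λ z → 2 * z + (f (a , a) + diagonal)) (∑-++ (map (a ,_) l) (pairs l) f) ⟨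
  2 * ∑ (map (a ,_) l ++ pairs l) f + (f (a , a) + diagonal) ∎
  where
  open ≡-Reasoning
  s = ∑[ y ∈ l ] f (a , y)
  diagonal = ∑[ x ∈ l ] f (x , x)
  rearrange : ∀ a s p d → a + s + (s + (2 * p + d)) ≡ 2 * (s + p) + (a + d)
  rearrange = solve-∀

even-or-suc-even : ∀ n → 2 ∣ n ⊎ 2 ∣ suc n
even-or-suc-even zero = inj₁ (divides 0 refl)
even-or-suc-even (suc n) with even-or-suc-even n
... | inj₁ (divides q refl) = inj₂ (divides (suc q) refl)
... | inj₂ even = inj₁ even

-- `_≈_` compares forward maps only; the inverses agree because each is determined by its forward
-- map.
↔-sym-cong : ∀ {s t : Sym A} → s ≈ t → ↔-sym s ≈ ↔-sym t
↔-sym-cong {s = s} {t} s≈t x = begin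
  Inverse.from s x                                      ≡⟨ cong (Inverse.from s) (Inverse.strictlyInverseˡ t x) ⟨
  Inverse.from s (Inverse.to t (Inverse.from t x))      ≡⟨ cong (Inverse.from s) (s≈t _) ⟨
  Inverse.from s (Inverse.to s (Inverse.from t x))      ≡⟨ Inverse.strictlyInverseʳ s _ ⟩
  Inverse.from t x                                      ∎
  where open ≡-Reasoning

module FiniteSet {X : Set} (_≟_ : DecidableEquality X)
  (vs : List X) (vs-unique : Unique vs) (vs-complete : ∀ x → x ∈ vs) where

  open Multigraph _≟_
  open OneFactorization _≟_ vs vs-unique vs-complete

  ∑-sift : ∀ (f : X → ℕ) x → ∑[ v ∈ vs ] (⟦ v ≟ x ⟧ * f v) ≡ f x
  ∑-sift f x = begin
    ∑[ v ∈ vs ] (⟦ v ≟ x ⟧ * f v)  ≡⟨ ∑-cong vs constant ⟩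
    ∑[ v ∈ vs ] (f x * ⟦ v ≟ x ⟧)  ≡⟨ ∑-*ˡ (f x) vs _ ⟩
    f x * ∑[ v ∈ vs ] ⟦ v ≟ x ⟧    ≡⟨ cong (f x *_) (Unique-count _≟_ vs-unique (vs-complete x)) ⟩
    f x * 1                        ≡⟨ *-identityʳ (f x) ⟩
    f x                            ∎
    where
    open ≡-Reasoning
    constant : ∀ v → ⟦ v ≟ x ⟧ * f v ≡ f x * ⟦ v ≟ x ⟧
    constant v with v ≟ x
    ... | yes refl = *-comm 1 (f x)
    ... | no _ = sym (*-zeroʳ (f x))

  ∑∑-sift : ∀ (f : X → X → ℕ) x y → ∑[ a ∈ vs ] ∑[ b ∈ vs ] (⟦ (a , b) ≟₂ (x , y) ⟧ * f a b) ≡ f x y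
  ∑∑-sift f x y = begin
    ∑[ a ∈ vs ] ∑[ b ∈ vs ] (⟦ (a , b) ≟₂ (x , y) ⟧ * f a b)          ≡⟨ ∑-cong vs (λ a → ∑-cong vs (factor a)) ⟩
    ∑[ a ∈ vs ] ∑[ b ∈ vs ] (⟦ a ≟ x ⟧ * (⟦ b ≟ y ⟧ * f a b))         ≡⟨ ∑-cong vs (λ a → ∑-*ˡ ⟦ a ≟ x ⟧ vs _) ⟩
    ∑[ a ∈ vs ] (⟦ a ≟ x ⟧ * ∑[ b ∈ vs ] (⟦ b ≟ y ⟧ * f a b))         ≡⟨ ∑-sift _ x ⟩
    ∑[ b ∈ vs ] (⟦ b ≟ y ⟧ * f x b)                                   ≡⟨ ∑-sift _ y ⟩
    f x y                                                             ∎
    where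
    open ≡-Reasoning
    factor : ∀ a b → ⟦ (a , b) ≟₂ (x , y) ⟧ * f a b ≡ ⟦ a ≟ x ⟧ * (⟦ b ≟ y ⟧ * f a b)
    factor a b = trans (cong (_* f a b) (trans
      (⟦⟧-cong ((a , b) ≟₂ (x , y)) (a ≟ x ×-dec b ≟ y) (λ { refl → refl , refl }) (λ { (refl , refl) → refl }))
      (⟦⟧-* (a ≟ x) (b ≟ y)))) (*-assoc ⟦ a ≟ x ⟧ _ _)

  valency : {R : X → X → Set} → Decidable R → X → ℕ
  valency R? x = ∑[ y ∈ vs ] ⟦ R? x y ⟧

  -- Counts in two orders the coincidences between entries of `vs` and of the duplicate-free list
  -- witnessing the size.
  HasSize⇒∑ : ∀ {P : X → Set} (P? : ∀ x → Dec (P x)) {k} → HasSize P k → ∑[ x ∈ vs ] ⟦ P? x ⟧ ≡ k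
  HasSize⇒∑ P? (l , l-unique , refl , l⊆P , P⊆l) = begin
    ∑[ x ∈ vs ] ⟦ P? x ⟧                  ≡⟨ ∑-cong vs count ⟩
    ∑[ x ∈ vs ] ∑[ z ∈ l ] ⟦ z ≟ x ⟧      ≡⟨ ∑-swap vs l _ ⟩
    ∑[ z ∈ l ] ∑[ x ∈ vs ] ⟦ z ≟ x ⟧      ≡⟨ ∑-cong l (λ z → ∑-cong vs λ x → ⟦⟧-cong (z ≟ x) (x ≟ z) sym sym) ⟩
    ∑[ z ∈ l ] ∑[ x ∈ vs ] ⟦ x ≟ z ⟧      ≡⟨ ∑-cong l (λ z → Unique-count _≟_ vs-unique (vs-complete z)) ⟩
    ∑[ z ∈ l ] 1                          ≡⟨ ∑-1 l ⟩
    length l                              ∎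
    where
    open ≡-Reasoning
    count : ∀ x → ⟦ P? x ⟧ ≡ ∑[ z ∈ l ] ⟦ z ≟ x ⟧
    count x with P? x
    ... | yes px = sym (Unique-count _≟_ l-unique (P⊆l px))
    ... | no ¬px = sym (trans (∑-cong-∈ l λ {z} z∈l → ⟦⟧-no (z ≟ x) λ { refl → ¬px (l⊆P z∈l) }) (∑-0 l))

  module _ {R : X → X → Set} (R? : Decidable R) (R-sym : Symmetric R) where

    ⟦R⟧-sym : ∀ x y → ⟦ R? x y ⟧ ≡ ⟦ R? y x ⟧
    ⟦R⟧-sym x y = ⟦⟧-cong (R? x y) (R? y x) R-sym R-sym

    private
      r : X → X → ℕ
      r x y = ⟦ R? x y ⟧

    ∑∑-+ : ∀ (f g : X × X → ℕ) → ∑[ a ∈ vs ] ∑[ b ∈ vs ] (r a b * (f (a , b) + g (a , b))) ≡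
      ∑[ a ∈ vs ] ∑[ b ∈ vs ] (f (a , b) * r a b) + ∑[ a ∈ vs ] ∑[ b ∈ vs ] (g (a , b) * r a b)
    ∑∑-+ f g = trans (∑-cong vs λ a → trans (∑-cong vs λ b →
      trans (*-comm (r a b) _) (*-distribʳ-+ (r a b) (f (a , b)) _)) (∑-+ vs _ _)) (∑-+ vs _ _)

    ∑-out : ∀ x → ∑[ a ∈ vs ] ∑[ b ∈ vs ] (⟦ a ≟ x ⟧ * r a b) ≡ valency R? x
    ∑-out x = trans (∑-cong vs λ a → ∑-*ˡ ⟦ a ≟ x ⟧ vs (r a)) (∑-sift (valency R?) x)

    ∑-in : ∀ x → ∑[ a ∈ vs ] ∑[ b ∈ vs ] (⟦ b ≟ x ⟧ * r a b) ≡ valency R? x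
    ∑-in x = ∑-cong vs λ a → trans (∑-sift (r a) x) (⟦R⟧-sym a x)

    arcs : List (X × X)
    arcs = concat (map (λ x → map (x ,_) (filter (R? x) vs)) vs)

    ∑-arcs : ∀ f → ∑ arcs f ≡ ∑[ x ∈ vs ] ∑[ y ∈ vs ] (f (x , y) * r x y)
    ∑-arcs f = trans (∑-concat vs _ f) (∑-cong vs λ x → trans (∑-map (x ,_) (filter (R? x) vs) f)
      (trans (∑-filter (R? x) vs _) (∑-cong vs λ y → *-comm (r x y) (f (x , y)))))

    arcs-biregular : ∀ {k} → (∀ x → valency R? x ≡ k) → Biregular k arcs
    arcs-biregular regular x =
      trans (∑-arcs _) (trans (∑-out x) (regular x)) , trans (∑-arcs _) (trans (∑-in x) (regular x))

    multiplicity-arcs : ∀ x y → multiplicity arcs x y ≡ ⟦ R? x y ⟧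
    multiplicity-arcs x y = trans (∑-arcs _) (∑∑-sift r x y)

    edges : List (X × X)
    edges = filter (λ e → R? (proj₁ e) (proj₂ e)) (pairs vs)

    -- The handshake lemma with weights: each edge is seen from both ends, and irreflexivity removes
    -- the diagonal. The constant weight 1 gives `total-valency-even`.
    ∑-edges : (∀ x → ¬ R x x) → ∀ f → Symmetric₂ f →
      2 * ∑ edges f ≡ ∑[ x ∈ vs ] ∑[ y ∈ vs ] (⟦ R? x y ⟧ * f (x , y))
    ∑-edges R-irrefl f f-sym = begin
      2 * ∑ edges f                                       ≡⟨ cong (2 *_) (∑-filter _ (pairs vs) f) ⟩
      2 * ∑ (pairs vs) g                                  ≡⟨ +-identityʳ _ ⟨
      2 * ∑ (pairs vs) g + 0                              ≡⟨ cong (2 * ∑ (pairs vs) g +_) diagonal ⟨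
      2 * ∑ (pairs vs) g + ∑[ x ∈ vs ] g (x , x)          ≡⟨ ∑∑-symmetric vs g g-sym ⟨
      ∑[ x ∈ vs ] ∑[ y ∈ vs ] (⟦ R? x y ⟧ * f (x , y))    ∎
      where
      open ≡-Reasoning
      g : X × X → ℕ
      g e = ⟦ R? (proj₁ e) (proj₂ e) ⟧ * f e
      g-sym : Symmetric₂ g
      g-sym x y = cong₂ _*_ (⟦R⟧-sym x y) (f-sym x y)
      diagonal : ∑[ x ∈ vs ] g (x , x) ≡ 0
      diagonal = trans (∑-cong vs λ x → cong (_* f (x , x)) (⟦⟧-no (R? x x) (R-irrefl x))) (∑-0 vs)

    total-valency-even : (∀ x → ¬ R x x) → 2 ∣ ∑[ x ∈ vs ] valency R? x
    total-valency-even R-irrefl = divides (∑[ _ ∈ edges ] 1)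
      (trans (∑-cong vs λ x → ∑-cong vs λ y → sym (*-identityʳ _))
        (trans (sym (∑-edges R-irrefl (λ _ → 1) λ _ _ → refl)) (*-comm 2 (∑[ _ ∈ edges ] 1))))

    -- In a balanced orientation `D` all in- and out-degrees are `k`, so `D` splits into
    -- permutations. Adding the two orders of `x` and `y` gives the sum over `D` of the symmetric
    -- weight `isEdge x y`, which equals its sum over `edges`. Both sides are doubled because
    -- `∑-edges` counts every edge twice.
    two-factorization : (∀ x → ¬ R x x) → ∀ k → (∀ x → valency R? x ≡ 2 * k) →
      ∃ λ (πs : List (Sym X)) → ∀ x y → ∑[ π ∈ πs ] (⟦ (x ^ π) ≟ y ⟧ + ⟦ (y ^ π) ≟ x ⟧) ≡ ⟦ R? x y ⟧
    two-factorization R-irrefl k regular = πs , λ x y → *-cancelˡ-≡ _ _ 2 (begin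
      2 * ∑[ π ∈ πs ] (⟦ (x ^ π) ≟ y ⟧ + ⟦ (y ^ π) ≟ x ⟧)
        ≡⟨ cong (2 *_) (trans (∑-+ πs _ _) (cong₂ _+_ (sym (decomposes x y)) (sym (decomposes y x)))) ⟩
      2 * (multiplicity D x y + multiplicity D y x)
        ≡⟨ cong (2 *_) (∑-+ D _ _) ⟨
      2 * ∑ D (isEdge x y)
        ≡⟨ cong (2 *_) (orients _ (isEdge-symmetric x y)) ⟩
      2 * ∑ edges (isEdge x y)
        ≡⟨ ∑-edges R-irrefl _ (isEdge-symmetric x y) ⟩
      ∑[ a ∈ vs ] ∑[ b ∈ vs ] (⟦ R? a b ⟧ * isEdge x y (a , b))
        ≡⟨ ∑∑-+ (λ e → ⟦ e ≟₂ (x , y) ⟧) (λ e → ⟦ e ≟₂ (y , x) ⟧) ⟩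
      ∑[ a ∈ vs ] ∑[ b ∈ vs ] (⟦ (a , b) ≟₂ (x , y) ⟧ * ⟦ R? a b ⟧) +
      ∑[ a ∈ vs ] ∑[ b ∈ vs ] (⟦ (a , b) ≟₂ (y , x) ⟧ * ⟦ R? a b ⟧)
        ≡⟨ cong₂ _+_ (∑∑-sift r x y) (∑∑-sift r y x) ⟩
      ⟦ R? x y ⟧ + ⟦ R? y x ⟧
        ≡⟨ cong (⟦ R? x y ⟧ +_) (trans (⟦R⟧-sym y x) (sym (+-identityʳ _))) ⟩
      2 * ⟦ R? x y ⟧ ∎)
      where
      open ≡-Reasoning

      degree≡ : ∀ x → degree edges x ≡ 2 * k
      degree≡ x = *-cancelˡ-≡ _ _ 2 (begin
        2 * degree edges x
          ≡⟨ ∑-edges R-irrefl _ (degree-symmetric x) ⟩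
        ∑[ a ∈ vs ] ∑[ b ∈ vs ] (⟦ R? a b ⟧ * (⟦ a ≟ x ⟧ + ⟦ b ≟ x ⟧))
          ≡⟨ ∑∑-+ (λ e → ⟦ proj₁ e ≟ x ⟧) (λ e → ⟦ proj₂ e ≟ x ⟧) ⟩
        ∑[ a ∈ vs ] ∑[ b ∈ vs ] (⟦ a ≟ x ⟧ * ⟦ R? a b ⟧) + ∑[ a ∈ vs ] ∑[ b ∈ vs ] (⟦ b ≟ x ⟧ * ⟦ R? a b ⟧)
          ≡⟨ cong₂ _+_ (∑-out x) (∑-in x) ⟩
        valency R? x + valency R? x
          ≡⟨ cong (valency R? x +_) (+-identityʳ _) ⟨
        2 * valency R? x
          ≡⟨ cong (2 *_) (regular x) ⟩
        2 * (2 * k) ∎)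

      orientation : ∃ λ D → Balanced D × Orients D edges
      orientation = balanced-orientation _ edges refl λ x → divides k (trans (degree≡ x) (*-comm 2 k))

      D = proj₁ orientation
      balanced = proj₁ (proj₂ orientation)
      orients = proj₂ (proj₂ orientation)

      out≡k : ∀ x → out D x ≡ k
      out≡k x = *-cancelˡ-≡ _ _ 2 (begin
        2 * out D x           ≡⟨ cong (out D x +_) (trans (+-identityʳ _) (balanced x)) ⟩
        out D x + in′ D x     ≡⟨ degree-out+in D x ⟨
        degree D x            ≡⟨ orients _ (degree-symmetric x) ⟩
        degree edges x        ≡⟨ degree≡ x ⟩
        2 * k                 ∎)

      factorization : ∃ λ (πs : List (Sym X)) → ∀ x y → multiplicity D x y ≡ ∑[ π ∈ πs ] ⟦ (x ^ π) ≟ y ⟧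
      factorization = one-factorization k D λ x → out≡k x , trans (sym (balanced x)) (out≡k x)

      πs = proj₁ factorization
      decomposes = proj₂ factorization

  -- Decompositions of the arc set into permutations, closed under inversion.

  -- One equation for two conditions: the permutations run along arcs only, and they cover every arc
  -- exactly once.
  Decomposes : List (Sym X) → {R : X → X → Set} → Decidable R → Set
  Decomposes πs R? = ∀ x y → ∑[ π ∈ πs ] ⟦ (x ^ π) ≟ y ⟧ ≡ ⟦ R? x y ⟧

  Decomposes⇒R : ∀ {R} (R? : Decidable R) {πs} → Decomposes πs R? → ∀ {π} → π ∈ πs → ∀ x → R x (x ^ π)
  Decomposes⇒R R? {πs} decomposes {π} π∈πs x = ⟦⟧-true (R? x (x ^ π)) (begin
    1                                   ≡⟨ ⟦⟧-yes ((x ^ π) ≟ (x ^ π)) refl ⟨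
    ⟦ (x ^ π) ≟ (x ^ π) ⟧               ≤⟨ ∑-∈ (λ ρ → ⟦ (x ^ ρ) ≟ (x ^ π) ⟧) π∈πs ⟩
    ∑[ ρ ∈ πs ] ⟦ (x ^ ρ) ≟ (x ^ π) ⟧   ≡⟨ decomposes x (x ^ π) ⟩
    ⟦ R? x (x ^ π) ⟧                    ∎)
    where open ≤-Reasoning

  InverseClosed : List (Sym X) → Set
  InverseClosed πs = ∀ {π} → π ∈ πs → ∃ λ ρ → ρ ∈ πs × ρ ≈ ↔-sym π

  inverse-closed : ∀ πs → InverseClosed (πs ++ map ↔-sym πs)
  inverse-closed πs {π} π∈ with ∈-++⁻ πs π∈
  ... | inj₁ π∈πs = ↔-sym π , ∈-++⁺ʳ πs (∈-map⁺ ↔-sym π∈πs) , λ _ → refl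
  ... | inj₂ π∈inverses with ∈-map⁻ ↔-sym π∈inverses
  ... | ρ , ρ∈πs , refl = ρ , ∈-++⁺ˡ ρ∈πs , λ _ → refl

  from≟ : ∀ (π : Sym X) x y → ⟦ Inverse.from π x ≟ y ⟧ ≡ ⟦ (y ^ π) ≟ x ⟧
  from≟ π x y = ⟦⟧-cong (Inverse.from π x ≟ y) ((y ^ π) ≟ x)
    (λ { refl → Inverse.strictlyInverseˡ π x }) (λ { refl → Inverse.strictlyInverseʳ π y })

  -- The second term in `two-factorization` counts the pairs that `π` runs through backwards; by
  -- `from≟` these belong to the inverse of `π`.
  even-decomposition : ∀ {R} (R? : Decidable R) → Symmetric R → (∀ x → ¬ R x x) →
    ∀ {k} → 2 ∣ k → (∀ x → valency R? x ≡ k) → ∃ λ πs → Decomposes πs R? × InverseClosed πs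
  even-decomposition R? R-sym R-irrefl (divides q refl) regular =
    πs ++ map ↔-sym πs , decomposes , inverse-closed πs
    where
    factorization = two-factorization R? R-sym R-irrefl q λ x → trans (regular x) (*-comm q 2)
    πs = proj₁ factorization

    decomposes : Decomposes (πs ++ map ↔-sym πs) R?
    decomposes x y = begin
      ∑[ π ∈ πs ++ map ↔-sym πs ] ⟦ (x ^ π) ≟ y ⟧
        ≡⟨ ∑-++ πs _ _ ⟩
      ∑[ π ∈ πs ] ⟦ (x ^ π) ≟ y ⟧ + ∑[ π ∈ map ↔-sym πs ] ⟦ (x ^ π) ≟ y ⟧
        ≡⟨ cong (∑[ π ∈ πs ] ⟦ (x ^ π) ≟ y ⟧ +_) (trans (∑-map ↔-sym πs _) (∑-cong πs λ π → from≟ π x y)) ⟩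
      ∑[ π ∈ πs ] ⟦ (x ^ π) ≟ y ⟧ + ∑[ π ∈ πs ] ⟦ (y ^ π) ≟ x ⟧
        ≡⟨ ∑-+ πs _ _ ⟨
      ∑[ π ∈ πs ] (⟦ (x ^ π) ≟ y ⟧ + ⟦ (y ^ π) ≟ x ⟧)
        ≡⟨ proj₂ factorization x y ⟩
      ⟦ R? x y ⟧ ∎
      where open ≡-Reasoning

  -- A matching is encoded as the involution exchanging the ends of its edges; the fixed points are
  -- the unmatched vertices.
  IsMatching : (X → X → Set) → (X → X) → Set
  IsMatching R m = ∀ x → m (m x) ≡ x × (m x ≢ x → R x (m x))

  IsPerfectMatching : (X → X → Set) → (X → X) → Set
  IsPerfectMatching R m = ∀ x → m (m x) ≡ x × R x (m x)

  matching↔ : ∀ R {m} → IsPerfectMatching R m → Sym X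
  matching↔ R {m} perfect = mk↔ₛ′ m m (proj₁ ∘ perfect) (proj₁ ∘ perfect)

  odd-decomposition : ∀ {R} (R? : Decidable R) → Symmetric R → (∀ x → ¬ R x x) →
    ∀ {k m} → ¬ 2 ∣ k → (∀ x → valency R? x ≡ k) → IsPerfectMatching R m →
    ∃ λ πs → Decomposes πs R? × InverseClosed πs
  odd-decomposition R? R-sym R-irrefl {zero} odd _ _ = contradiction (divides 0 refl) odd
  odd-decomposition {R} R? R-sym R-irrefl {suc k} {m} odd regular perfect =
    matching↔ R perfect ∷ πs ,
    (λ x y → trans (cong (⟦ m x ≟ y ⟧ +_) (proj₁ (proj₂ rest) x y)) (removal x y)) ,
    λ { (here refl) → matching↔ R perfect , here refl , λ _ → refl
      ; (there π∈πs) → let ρ , ρ∈πs , eq = proj₂ (proj₂ rest) π∈πs in ρ , there ρ∈πs , eq }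
    where
    k-even : 2 ∣ k
    k-even = [ id , (λ even → contradiction even odd) ]′ (even-or-suc-even k)

    R′ : X → X → Set
    R′ x y = R x y × m x ≢ y

    R′? : Decidable R′
    R′? x y = R? x y ×-dec ¬? (m x ≟ y)

    removal : ∀ x y → ⟦ m x ≟ y ⟧ + ⟦ R′? x y ⟧ ≡ ⟦ R? x y ⟧
    removal x y with m x ≟ y
    ... | yes refl = trans (cong suc (⟦⟧-no (R? x y ×-dec ¬? (yes (refl {x = m x}))) λ (_ , ≢) → ≢ refl)) (sym (⟦⟧-yes (R? x y) (proj₂ (perfect x))))
    ... | no ≢ = ⟦⟧-cong (R? x y ×-dec yes ≢) (R? x y) proj₁ (_, ≢)

    R′-sym : Symmetric R′
    R′-sym {x} (r , mx≢y) = R-sym r , λ { refl → mx≢y (proj₁ (perfect _)) }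

    R′-valency : ∀ x → valency R′? x ≡ k
    R′-valency x = suc-injective (begin
      1 + valency R′? x                                       ≡⟨ cong (_+ valency R′? x) (Unique-count _≟_ vs-unique (vs-complete (m x))) ⟨
      ∑[ y ∈ vs ] ⟦ y ≟ m x ⟧ + valency R′? x                 ≡⟨ ∑-+ vs _ _ ⟨
      ∑[ y ∈ vs ] (⟦ y ≟ m x ⟧ + ⟦ R′? x y ⟧)                 ≡⟨ ∑-cong vs (λ y → trans (cong (_+ ⟦ R′? x y ⟧) (⟦⟧-cong (y ≟ m x) (m x ≟ y) sym sym)) (removal x y)) ⟩
      valency R? x                                            ≡⟨ regular x ⟩
      suc k                                                   ∎)
      where open ≡-Reasoning

    rest : ∃ λ πs → Decomposes πs R′? × InverseClosed πs
    rest = even-decomposition R′? R′-sym (λ x → R-irrefl x ∘ proj₁) k-even R′-valency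

    πs = proj₁ rest

  -- A permutation along edges of a bipartite graph, used on one part and
  -- inverted on the other, is a perfect matching.
  fold-permutation : ∀ {R} → Symmetric R → (part : X → Bool) → (∀ {x y} → R x y → part x ≢ part y) →
    (π : Sym X) → (∀ x → R x (x ^ π)) → IsPerfectMatching R (λ x → if part x then x ^ π else Inverse.from π x)
  fold-permutation {R} R-sym part proper π along x = case-part (part x) refl
    where
    open Inverse π using (from; strictlyInverseˡ; strictlyInverseʳ)

    m : X → X
    m x = if part x then x ^ π else from x

    along⁻¹ : R (from x) x
    along⁻¹ = subst (R (from x)) (strictlyInverseˡ x) (along (from x))

    m-true : ∀ {x} → part x ≡ true → m x ≡ x ^ π
    m-true eq = cong (if_then _ else _) eq

    m-false : ∀ {x} → part x ≡ false → m x ≡ from x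
    m-false eq = cong (if_then _ else _) eq

    case-part : ∀ b → part x ≡ b → m (m x) ≡ x × R x (m x)
    case-part true eq =
      trans (cong m (m-true eq)) (trans (m-false (trans (¬-not (proper (R-sym (along x)))) (cong not eq))) (strictlyInverseʳ x)) ,
      subst (R x) (sym (m-true eq)) (along x)
    case-part false eq =
      trans (cong m (m-false eq)) (trans (m-true (trans (¬-not (proper along⁻¹)) (cong not eq))) (strictlyInverseˡ x)) ,
      subst (R x) (sym (m-false eq)) (R-sym along⁻¹)

  -- At a vertex of the part `true` the folded involutions act as the permutations of König's
  -- factorization, elsewhere as their inverses. The inverses cover each arc once too, since `R` is
  -- symmetric.
  bipartite-decomposition : ∀ {R} (R? : Decidable R) → Symmetric R →
    (part : X → Bool) → (∀ {x y} → R x y → part x ≢ part y) →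
    ∀ {k} → (∀ x → valency R? x ≡ k) → ∃ λ πs → Decomposes πs R? × InverseClosed πs
  bipartite-decomposition {R} R? R-sym part proper {k} regular =
    let πs , multiplicity≡ = one-factorization k (arcs R? R-sym) (arcs-biregular R? R-sym regular)
        decomposes = λ x y → trans (sym (multiplicity≡ x y)) (multiplicity-arcs R? R-sym x y)
        ρs , involutive , ρs≡ = folded πs (All.tabulate (Decomposes⇒R R? decomposes))
    in ρs , (λ x y → trans (ρs≡ x y) (if-same (part x) (decomposes x y)
               (trans (decomposes y x) (⟦R⟧-sym R? R-sym y x)))) ,
       λ {ρ} ρ∈ρs → ρ , ρ∈ρs , All.lookup involutive ρ∈ρs
    where
    if-same : ∀ b {m n o : ℕ} → m ≡ o → n ≡ o → (if b then m else n) ≡ o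
    if-same true m≡o _ = m≡o
    if-same false _ n≡o = n≡o

    folded : ∀ πs → All (λ π → ∀ x → R x (x ^ π)) πs →
      ∃ λ (ρs : List (Sym X)) → All (λ ρ → ρ ≈ ↔-sym ρ) ρs × (∀ x y → ∑[ ρ ∈ ρs ] ⟦ (x ^ ρ) ≟ y ⟧ ≡
        (if part x then ∑[ π ∈ πs ] ⟦ (x ^ π) ≟ y ⟧ else ∑[ π ∈ πs ] ⟦ (y ^ π) ≟ x ⟧))
    folded [] [] = [] , [] , λ x y → sym (if-same (part x) refl refl)
    folded (π ∷ πs) (along ∷ alongs) =
      let ρs , involutive , ρs≡ = folded πs alongs
      in matching↔ R (fold-permutation R-sym part proper π along) ∷ ρs , (λ _ → refl) ∷ involutive ,
         λ x y → add (part x) x y (ρs≡ x y)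
      where
      add : ∀ b x y {s t t′} → s ≡ (if b then t else t′) →
        ⟦ (if b then x ^ π else Inverse.from π x) ≟ y ⟧ + s ≡
        (if b then ⟦ (x ^ π) ≟ y ⟧ + t else ⟦ (y ^ π) ≟ x ⟧ + t′)
      add true x y refl = refl
      add false x y refl = cong (_+ _) (from≟ π x y)

  -- Closed sets of derangements from decompositions.

  module _ (x₀ : X) (G : SimpleDigraph X) (G-sym : IsSimpleGraph G) (arc? : Decidable (Arc G)) where

    -- Closure under inversion yields `orbits`, looplessness yields `derangements`, and covering
    -- each arc only once yields `quotients`. The set `S` is `πs` saturated under `_≈_`.
    closed-graph : ∀ {πs} → Decomposes πs arc? → InverseClosed πs → Regular G → HasArc G → ClosedDAGraph G
    closed-graph {πs} decomposes inverse-closed regular (a , b , ab) = record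
      { isSimpleGraph = G-sym
      ; regular = regular
      ; S = S
      ; closed = record
        { respects-≈ = λ {s} {t} s≈t (π , π∈πs , s≈π) → π , π∈πs , λ x → trans (sym (s≈t x)) (s≈π x)
        ; point = x₀
        ; nonEmpty = let π , π∈πs , _ = arc⇒π ab in π , π , π∈πs , λ _ → refl
        ; derangements = λ (π , π∈πs , s≈π) x xˢ≡x → loopless G (π⇒arc π∈πs x) (sym (trans (sym (s≈π x)) xˢ≡x))
        ; orbits = λ x → (λ (s , s∈S , eq) → s , proj₁ self-inverse {s} s∈S , eq) ,
                          λ (s , s∈S⁻¹ , eq) → s , proj₂ self-inverse {s} s∈S⁻¹ , eq
        ; quotients = λ {s} → quotients {s}
        }
      ; selfInverse = self-inverse
      ; G≡DA = (λ {x} xy → let π , π∈πs , eq = arc⇒π xy in π , (π , π∈πs , λ _ → refl) , eq) ,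
               λ { {x} (s , (π , π∈πs , s≈π) , refl) → subst (Arc G x) (sym (s≈π x)) (π⇒arc π∈πs x) }
      }
      where
      S : Sym X → Set
      S s = ∃ λ π → π ∈ πs × s ≈ π

      arc⇒π : ∀ {x y} → Arc G x y → ∃ λ π → π ∈ πs × x ^ π ≡ y
      arc⇒π {x} {y} xy =
        let π , π∈πs , pos = ∑-positive πs (≤-reflexive (sym (trans (decomposes x y) (⟦⟧-yes (arc? x y) xy))))
        in π , π∈πs , ⟦⟧-true ((x ^ π) ≟ y) pos

      π⇒arc : ∀ {π} → π ∈ πs → ∀ x → Arc G x (x ^ π)
      π⇒arc = Decomposes⇒R arc? decomposes

      self-inverse : SelfInverse S
      self-inverse =
        (λ { {s} (π , π∈πs , s≈π) → let ρ , ρ∈πs , eq = inverse-closed π∈πs in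
          ↔-sym s , (ρ , ρ∈πs , λ x → trans (↔-sym-cong {s = s} {π} s≈π x) (sym (eq x))) , λ _ → refl }) ,
        λ { {s} (t , (π , π∈πs , t≈π) , s≈t⁻¹) → let ρ , ρ∈πs , eq = inverse-closed π∈πs in
          ρ , ρ∈πs , λ x → trans (s≈t⁻¹ x) (trans (↔-sym-cong {s = t} {π} t≈π x) (sym (eq x))) }

      quotient-image : ∀ {s a b c π ρ : Sym X} → s ≈ a · b → b ≈ ↔-sym c → a ≈ π → c ≈ ρ →
        ∀ x → x ^ s ≡ Inverse.from ρ (x ^ π)
      quotient-image {c = c} {ρ = ρ} s≈ab b≈c⁻¹ a≈π c≈ρ x =
        trans (s≈ab x) (trans (b≈c⁻¹ _) (trans (↔-sym-cong {s = c} {ρ} c≈ρ _) (cong (Inverse.from ρ) (a≈π x))))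

      quotients : ∀ {s} → (S ⊙ S ⁻¹) s → Der s ⊎ ｛1｝ s
      quotients {s} (a , b , (π , π∈πs , a≈π) , (c , (ρ , ρ∈πs , c≈ρ) , b≈c⁻¹) , s≈ab) with ∑-pair π∈πs ρ∈πs
      -- At the same position the quotient is the identity. At different positions, a fixed point
      -- `x` of `s` would give `x ^ π ≡ x ^ ρ`, an arc covered twice.
      ... | inj₁ refl = inj₂ λ x → trans (quotient-image {s} {a} {b} {c} {π} {ρ} s≈ab b≈c⁻¹ a≈π c≈ρ x) (Inverse.strictlyInverseʳ π x)
      ... | inj₂ two = inj₁ λ x xˢ≡x → contradiction (≤-trans (two-arcs x xˢ≡x) (⟦⟧≤1 (arc? x (x ^ π)))) λ { (s≤s ()) }
        where
        two-arcs : ∀ x → x ^ s ≡ x → 2 ≤ ⟦ arc? x (x ^ π) ⟧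
        two-arcs x xˢ≡x = begin
          1 + 1                                              ≡⟨ cong₂ _+_ (⟦⟧-yes ((x ^ π) ≟ (x ^ π)) refl) (⟦⟧-yes ((x ^ ρ) ≟ (x ^ π)) same-image) ⟨
          ⟦ (x ^ π) ≟ (x ^ π) ⟧ + ⟦ (x ^ ρ) ≟ (x ^ π) ⟧      ≤⟨ two (λ σ → ⟦ (x ^ σ) ≟ (x ^ π) ⟧) ⟩
          ∑[ σ ∈ πs ] ⟦ (x ^ σ) ≟ (x ^ π) ⟧                  ≡⟨ decomposes x (x ^ π) ⟩
          ⟦ arc? x (x ^ π) ⟧                                 ∎
          where
          open ≤-Reasoning
          same-image : x ^ ρ ≡ x ^ π
          same-image = trans (cong (_^ ρ) (trans (sym xˢ≡x) (quotient-image {s} {a} {b} {c} {π} {ρ} s≈ab b≈c⁻¹ a≈π c≈ρ x))) (Inverse.strictlyInverseˡ ρ (x ^ π))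

-- Maximum matchings and Gallai's lemma.

-- Without a minimum, every value could be undercut, an infinite descent in ℕ. As `P` is an
-- arbitrary predicate, the minimum is obtained only under a double negation.
¬¬-minimum : (P : A → Set) (f : A → ℕ) → ∃ P → ¬ ¬ ∃ λ a → P a × (∀ b → P b → f a ≤ f b)
¬¬-minimum P f (a , pa) no-minimum = none-below (suc (f a)) a pa ≤-refl
  where
  none-below : ∀ n a → P a → ¬ f a < n
  none-below (suc n) a pa (s≤s fa≤n) =
    no-minimum (a , pa , λ b pb → ≮⇒≥ λ fb<fa → none-below n b pb (≤-trans fb<fa fa≤n))

-- Serves proofs of `⊥`, in which membership in an orbit or a component may be taken as decided at
-- the finitely many vertices.
¬¬-all-decidable : (C : A → Set) (l : List A) → ¬ ¬ All (Dec ∘ C) l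
¬¬-all-decidable C [] k = k []
¬¬-all-decidable C (x ∷ l) k = ¬¬-excluded-middle λ d → ¬¬-all-decidable C l λ ds → k (d ∷ ds)

-- In the orbit of a fixed point x of N under two involutions M and N, the
-- products σ = N ∘ M act as a cyclic group: the orbit of x under σ has odd
-- length if it contains a fixed point of M, which then lies opposite to x.
module Dihedral {X : Set} {M N : X → X} (M-involutive : ∀ y → M (M y) ≡ y) (N-involutive : ∀ y → N (N y) ≡ y)
  {x : X} (Nx≡x : N x ≡ x) where

  private
    σ : X → X
    σ y = N (M y)

  -- As `N` fixes `x` and conjugates `σ` to its inverse, the second form is the image of `x` under
  -- the negative power `-i` of `σ`.
  Orbit : X → Set
  Orbit y = ∃ λ i → y ≡ fold x σ i ⊎ y ≡ N (fold x σ i)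

  M-orbit : ∀ {y} → Orbit y → Orbit (M y)
  M-orbit (i , inj₁ refl) = suc i , inj₂ (sym (N-involutive _))
  M-orbit (zero , inj₂ refl) = 1 , inj₂ (trans (cong M Nx≡x) (sym (N-involutive _)))
  M-orbit (suc i , inj₂ refl) = i , inj₁ (trans (cong M (N-involutive _)) (M-involutive _))

  N-orbit : ∀ {y} → Orbit y → Orbit (N y)
  N-orbit (i , inj₁ refl) = i , inj₂ refl
  N-orbit (i , inj₂ refl) = i , inj₁ (N-involutive _)

  private
    fold-shift : ∀ y i → fold (σ y) σ i ≡ σ (fold y σ i)
    fold-shift y zero = refl
    fold-shift y (suc i) = cong σ (fold-shift y i)

    fold-N : ∀ i → fold (N (fold x σ i)) σ i ≡ x
    fold-N zero = Nx≡x
    fold-N (suc i) = trans (sym (fold-shift _ i))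
      (trans (cong (λ y → fold y σ i) (cong N (trans (cong M (N-involutive _)) (M-involutive _)))) (fold-N i))

    fixed-power : ∀ {u} → Orbit u → M u ≡ u → ∃ λ i → u ≡ fold x σ i
    fixed-power (i , inj₁ eq) _ = i , eq
    fixed-power (zero , inj₂ refl) _ = 0 , Nx≡x
    fixed-power (suc i , inj₂ refl) Mu≡u =
      i , trans (sym Mu≡u) (trans (cong M (N-involutive _)) (M-involutive _))

    -- If `M` fixes `fold x σ i`, the next point of the orbit is `N (fold x σ i)`, from which `i`
    -- further steps lead back to `x` by `fold-N`.
    period : ∀ i → M (fold x σ i) ≡ fold x σ i → fold x σ (i + suc i) ≡ x
    period i fixed = trans (fold-+ x σ i) (trans (cong (λ y → fold (N y) σ i) fixed) (fold-N i))

    period-multiple : ∀ {p} → fold x σ p ≡ x → ∀ a → fold x σ (a * p) ≡ x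
    period-multiple eq zero = refl
    period-multiple {p} eq (suc a) =
      trans (fold-+ x σ p) (trans (cong (λ y → fold y σ p) (period-multiple eq a)) eq)

    periodic : ∀ {p} → fold x σ p ≡ x → ∀ i a → fold x σ (i + a * p) ≡ fold x σ i
    periodic eq i a = trans (fold-+ x σ i) (cong (λ y → fold y σ i) (period-multiple eq a))

  -- If `M` fixes the points with exponents `i` and `j`, then `2i+1` and `2j+1` are periods of `x`,
  -- and adding multiples of them raises both exponents to `2ij+i+j`.
  M-fixed-unique : ∀ {u v} → Orbit u → Orbit v → M u ≡ u → M v ≡ v → u ≡ v
  M-fixed-unique u∈ v∈ Mu≡u Mv≡v with fixed-power u∈ Mu≡u | fixed-power v∈ Mv≡v
  ... | i , refl | j , refl = begin
    fold x σ i                    ≡⟨ periodic (period i Mu≡u) i j ⟨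
    fold x σ (i + j * (i + suc i))  ≡⟨ cong (fold x σ) (exponents i j) ⟩
    fold x σ (j + i * (j + suc j))  ≡⟨ periodic (period j Mv≡v) j i ⟩
    fold x σ j                    ∎
    where
    open ≡-Reasoning
    exponents : ∀ i j → i + j * (i + suc i) ≡ j + i * (j + suc j)
    exponents = solve-∀

module Matchings {X : Set} (_≟_ : DecidableEquality X)
  (vs : List X) (vs-unique : Unique vs) (vs-complete : ∀ x → x ∈ vs)
  {R : X → X → Set} (R? : Decidable R) (R-sym : Symmetric R) (R-irrefl : ∀ x → ¬ R x x) where

  open FiniteSet _≟_ vs vs-unique vs-complete

  unmatched : (X → X) → ℕ
  unmatched m = ∑[ x ∈ vs ] ⟦ m x ≟ x ⟧

  IsMaximum : (X → X) → Set
  IsMaximum m = IsMatching R m × (∀ n → IsMatching R n → unmatched m ≤ unmatched n)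

  join : X → X → (X → X) → X → X
  join u v m x = if does (x ≟ u) then v else if does (x ≟ v) then u else m x

  -- Otherwise adding the edge between `u` and `v` would leave fewer vertices unmatched.
  adjacent-unmatched : ∀ {u v} → R u v → ∀ {m} → IsMaximum m → m u ≡ u → m v ≡ v → ⊥
  adjacent-unmatched {u} {v} uv {m} (matching , maximum) mu≡u mv≡v =
    1+n≰n (≤-trans fewer (maximum m′ m′-matching))
    where
    m′ : X → X
    m′ = join u v m

    u≢v : u ≢ v
    u≢v refl = R-irrefl u uv

    m′-u : m′ u ≡ v
    m′-u with u ≟ u
    ... | yes _ = refl
    ... | no u≢u = contradiction refl u≢u

    m′-v : m′ v ≡ u
    m′-v with v ≟ u | v ≟ v
    ... | yes v≡u | _ = v≡u
    ... | no _ | yes _ = refl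
    ... | no _ | no v≢v = contradiction refl v≢v

    m′-other : ∀ {x} → x ≢ u → x ≢ v → m′ x ≡ m x
    m′-other {x} x≢u x≢v with x ≟ u | x ≟ v
    ... | yes x≡u | _ = contradiction x≡u x≢u
    ... | no _ | yes x≡v = contradiction x≡v x≢v
    ... | no _ | no _ = refl

    avoids : ∀ {x z} → m z ≡ z → x ≢ z → m x ≢ z
    avoids mz≡z x≢z mx≡z = x≢z (trans (sym (proj₁ (matching _))) (trans (cong m mx≡z) mz≡z))

    m′-matching : IsMatching R m′
    m′-matching x = by-cases (x ≟ u) (x ≟ v)
      where
      by-cases : Dec (x ≡ u) → Dec (x ≡ v) → m′ (m′ x) ≡ x × (m′ x ≢ x → R x (m′ x))
      by-cases (yes refl) _ = trans (cong m′ m′-u) m′-v , λ _ → subst (R x) (sym m′-u) uv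
      by-cases (no _) (yes refl) = trans (cong m′ m′-v) m′-u , λ _ → subst (R x) (sym m′-v) (R-sym uv)
      by-cases (no x≢u) (no x≢v) =
        trans (cong m′ (m′-other x≢u x≢v))
          (trans (m′-other (avoids mu≡u x≢u) (avoids mv≡v x≢v)) (proj₁ (matching x))) ,
        λ m′x≢x → subst (R x) (sym (m′-other x≢u x≢v)) (proj₂ (matching x) (m′x≢x ∘ trans (m′-other x≢u x≢v)))

    fewer-at : ∀ x → ⟦ x ≟ u ⟧ + ⟦ m′ x ≟ x ⟧ ≤ ⟦ m x ≟ x ⟧
    fewer-at x = by-cases (x ≟ u) (x ≟ v)
      where
      open ≤-Reasoning
      by-cases : Dec (x ≡ u) → Dec (x ≡ v) → ⟦ x ≟ u ⟧ + ⟦ m′ x ≟ x ⟧ ≤ ⟦ m x ≟ x ⟧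
      by-cases (yes refl) _ = begin
        ⟦ x ≟ u ⟧ + ⟦ m′ x ≟ x ⟧  ≡⟨ cong₂ _+_ (⟦⟧-yes (x ≟ u) refl) (⟦⟧-no (m′ x ≟ x) λ m′x≡x → u≢v (trans (sym m′x≡x) m′-u)) ⟩
        1                         ≡⟨ ⟦⟧-yes (m x ≟ x) mu≡u ⟨
        ⟦ m x ≟ x ⟧               ∎
      by-cases (no x≢u) x≟v = begin
        ⟦ x ≟ u ⟧ + ⟦ m′ x ≟ x ⟧  ≡⟨ cong (_+ ⟦ m′ x ≟ x ⟧) (⟦⟧-no (x ≟ u) x≢u) ⟩
        ⟦ m′ x ≟ x ⟧              ≤⟨ ⟦⟧-mono (m′ x ≟ x) (m x ≟ x) (still-unmatched x≟v) ⟩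
        ⟦ m x ≟ x ⟧               ∎
        where
        still-unmatched : Dec (x ≡ v) → m′ x ≡ x → m x ≡ x
        still-unmatched (yes refl) _ = mv≡v
        still-unmatched (no x≢v) m′x≡x = trans (sym (m′-other x≢u x≢v)) m′x≡x

    fewer : suc (unmatched m′) ≤ unmatched m
    fewer = begin
      1 + unmatched m′                                ≡⟨ cong (_+ unmatched m′) (Unique-count _≟_ vs-unique (vs-complete u)) ⟨
      ∑[ x ∈ vs ] ⟦ x ≟ u ⟧ + unmatched m′            ≡⟨ ∑-+ vs _ _ ⟨
      ∑[ x ∈ vs ] (⟦ x ≟ u ⟧ + ⟦ m′ x ≟ x ⟧)          ≤⟨ ∑-mono vs fewer-at ⟩
      unmatched m                                     ∎
      where open ≤-Reasoning

  module Switch {C : X → Set} (C? : ∀ x → Dec (C x)) where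

    switch : (X → X) → (X → X) → X → X
    switch m n x = if does (C? x) then n x else m x

    switch-inside : ∀ m n {x} → C x → switch m n x ≡ n x
    switch-inside m n {x} c with C? x
    ... | yes _ = refl
    ... | no ¬c = contradiction c ¬c

    switch-outside : ∀ m n {x} → ¬ C x → switch m n x ≡ m x
    switch-outside m n {x} ¬c with C? x
    ... | yes c = contradiction c ¬c
    ... | no _ = refl

    module _ {m n} (m-matching : IsMatching R m) (n-matching : IsMatching R n)
      (m-closed : ∀ {x} → C x → C (m x)) (n-closed : ∀ {x} → C x → C (n x)) where

      switch-matching : IsMatching R (switch m n)
      switch-matching x = by-cases (C? x)
        where
        m′ : X → X
        m′ = switch m n

        by-cases : Dec (C x) → m′ (m′ x) ≡ x × (m′ x ≢ x → R x (m′ x))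
        by-cases (yes c) =
          trans (cong m′ eq) (trans (switch-inside m n (n-closed c)) (proj₁ (n-matching x))) ,
          λ m′x≢x → subst (R x) (sym eq) (proj₂ (n-matching x) (m′x≢x ∘ trans eq))
          where
          eq = switch-inside m n c
        by-cases (no ¬c) =
          trans (cong m′ eq) (trans (switch-outside m n ¬c′) (proj₁ (m-matching x))) ,
          λ m′x≢x → subst (R x) (sym eq) (proj₂ (m-matching x) (m′x≢x ∘ trans eq))
          where
          eq = switch-outside m n ¬c
          ¬c′ : ¬ C (m x)
          ¬c′ c = ¬c (subst C (proj₁ (m-matching x)) (m-closed c))

    unmatched-switch : ∀ m n → unmatched (switch m n) + unmatched (switch n m) ≡ unmatched m + unmatched n
    unmatched-switch m n = trans (sym (∑-+ vs _ _)) (trans (∑-cong vs λ x → by-cases x (C? x)) (∑-+ vs _ _))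
      where
      by-cases : ∀ x → Dec (C x) → ⟦ switch m n x ≟ x ⟧ + ⟦ switch n m x ≟ x ⟧ ≡ ⟦ m x ≟ x ⟧ + ⟦ n x ≟ x ⟧
      by-cases x (yes c) = trans (cong₂ (λ a b → ⟦ a ≟ x ⟧ + ⟦ b ≟ x ⟧) (switch-inside m n c) (switch-inside n m c))
        (+-comm ⟦ n x ≟ x ⟧ _)
      by-cases x (no ¬c) = cong₂ (λ a b → ⟦ a ≟ x ⟧ + ⟦ b ≟ x ⟧) (switch-outside m n ¬c) (switch-outside n m ¬c)

    -- Switching both ways preserves the total number of unmatched vertices. As `switch n m` cannot
    -- do better than `n`, `switch m n` does no worse than `m`.
    switch-maximum : ∀ {m n} → IsMaximum m → IsMaximum n →
      (∀ {x} → C x → C (m x)) → (∀ {x} → C x → C (n x)) → IsMaximum (switch m n)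
    switch-maximum {m} {n} (m-matching , m-maximum) (n-matching , n-maximum) m-closed n-closed =
      switch-matching m-matching n-matching m-closed n-closed ,
      λ m′ m′-matching → ≤-trans as-good (m-maximum m′ m′-matching)
      where
      open ≤-Reasoning
      as-good : unmatched (switch m n) ≤ unmatched m
      as-good = +-cancelʳ-≤ (unmatched n) _ _ (begin
        unmatched (switch m n) + unmatched n                ≤⟨ +-monoʳ-≤ _ (n-maximum _ (switch-matching n-matching m-matching n-closed m-closed)) ⟩
        unmatched (switch m n) + unmatched (switch n m)     ≡⟨ unmatched-switch m n ⟩
        unmatched m + unmatched n                           ∎)

  Avoidable : X → Set
  Avoidable x = ∃ λ m → IsMaximum m × m x ≡ x

  -- Gallai's lemma, by induction on a path from u to v. If x is the second
  -- vertex of the path and n is a maximum matching avoiding x, then switching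
  -- m to n on the component of x gives a maximum matching which avoids x and
  -- one of u, v, because the component cannot contain both.
  gallai : (∀ x → Avoidable x) → ∀ {u v} → Star R u v → u ≢ v → ∀ {m} → IsMaximum m → m u ≡ u → m v ≡ v → ⊥
  gallai avoidable ε u≢u _ _ _ = u≢u refl
  gallai avoidable {u} {v} (_◅_ {j = x} ux path) u≢v {m} max mu≡u mv≡v with x ≟ v
  ... | yes refl = adjacent-unmatched ux max mu≡u mv≡v
  ... | no x≢v = ¬¬-all-decidable Orbit vs λ orbit-dec → by-cases λ y → All.lookup orbit-dec (vs-complete y)
    where
    n = proj₁ (avoidable x)
    n-max = proj₁ (proj₂ (avoidable x))
    nx≡x = proj₂ (proj₂ (avoidable x))

    open Dihedral {M = m} {n} (proj₁ ∘ proj₁ max) (proj₁ ∘ proj₁ n-max) nx≡x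

    by-cases : (∀ y → Dec (Orbit y)) → ⊥
    by-cases orbit? = cases (orbit? u) (orbit? v)
      where
      open Switch orbit?

      m′-max : IsMaximum (switch m n)
      m′-max = switch-maximum max n-max M-orbit N-orbit

      m′x≡x : switch m n x ≡ x
      m′x≡x = trans (switch-inside m n (0 , inj₁ refl)) nx≡x

      cases : Dec (Orbit u) → Dec (Orbit v) → ⊥
      cases (yes u∈) (yes v∈) = u≢v (M-fixed-unique u∈ v∈ mu≡u mv≡v)
      -- The switched matching avoids the adjacent vertices `u` and `x`; in the next case it avoids
      -- `x` and `v`, which the shorter path joins.
      cases (no u∉) _ = adjacent-unmatched ux m′-max (trans (switch-outside m n u∉) mu≡u) m′x≡x
      cases (yes _) (no v∉) = gallai avoidable path x≢v m′-max m′x≡x (trans (switch-outside m n v∉) mv≡v)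

  -- The component of u has odd order by the matching m, and even order by the
  -- handshake lemma.
  odd-valency-matched : (∀ x → Avoidable x) → ∀ {k} → ¬ 2 ∣ k → (∀ x → valency R? x ≡ k) →
    ∀ {m} → IsMaximum m → ∀ u → m u ≢ u
  odd-valency-matched avoidable {k} odd regular {m} max@(matching , _) u mu≡u =
    ¬¬-all-decidable C vs λ C-dec → parity λ y → All.lookup C-dec (vs-complete y)
    where
    C : X → Set
    C = Star R u

    only-u : ∀ {y} → C y → m y ≡ y → y ≡ u
    only-u {y} path my≡y with u ≟ y
    ... | yes refl = refl
    ... | no u≢y = ⊥-elim (gallai avoidable path u≢y max mu≡u my≡y)

    parity : (∀ y → Dec (C y)) → ⊥
    parity C? = contradiction (∣1⇒≡1 (∣m+n∣m⇒∣n (subst (2 ∣_) (trans order (+-comm 1 _)) even-order) (total-valency-even Matched? Matched-sym Matched-irrefl))) λ ()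
      where
      open ≡-Reasoning

      -- The arcs within the component number `k` times its order. This is even, so the order is
      -- even for odd `k`.
      Inside : X → X → Set
      Inside y z = C y × R y z

      Inside? : Decidable Inside
      Inside? y z = C? y ×-dec R? y z

      -- The matching edges in the component form a graph with valency 1 at every vertex of the
      -- component except `u`, so its even total valency is the order less one.
      Matched : X → X → Set
      Matched y z = z ≡ m y × C y × m y ≢ y

      Matched? : Decidable Matched
      Matched? y z = z ≟ m y ×-dec C? y ×-dec ¬? (m y ≟ y)

      Matched-sym : Symmetric Matched
      Matched-sym {y} (refl , c , my≢y) = sym (proj₁ (matching y)) , c ◅◅ proj₂ (matching y) my≢y ◅ ε ,
        λ mmy≡my → my≢y (trans (sym mmy≡my) (proj₁ (matching y)))

      Matched-irrefl : ∀ y → ¬ Matched y y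
      Matched-irrefl y (y≡my , _ , my≢y) = my≢y (sym y≡my)

      order : ∑[ y ∈ vs ] ⟦ C? y ⟧ ≡ 1 + ∑[ y ∈ vs ] valency Matched? y
      order = begin
        ∑[ y ∈ vs ] ⟦ C? y ⟧                                          ≡⟨ ∑-cong vs split ⟩
        ∑[ y ∈ vs ] (⟦ y ≟ u ⟧ + valency Matched? y)                  ≡⟨ ∑-+ vs _ _ ⟩
        ∑[ y ∈ vs ] ⟦ y ≟ u ⟧ + ∑[ y ∈ vs ] valency Matched? y        ≡⟨ cong (_+ ∑[ y ∈ vs ] valency Matched? y) (Unique-count _≟_ vs-unique (vs-complete u)) ⟩
        1 + ∑[ y ∈ vs ] valency Matched? y                            ∎
        where
        by-cases : ∀ y → Dec (y ≡ u) → ⟦ C? y ⟧ ≡ ⟦ y ≟ u ⟧ + ⟦ C? y ×-dec ¬? (m y ≟ y) ⟧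
        by-cases y (yes refl) = trans (⟦⟧-yes (C? y) ε) (cong₂ _+_ (sym (⟦⟧-yes (y ≟ u) refl))
          (sym (⟦⟧-no (C? y ×-dec ¬? (m y ≟ y)) λ (_ , my≢y) → my≢y mu≡u)))
        by-cases y (no y≢u) = trans
          (⟦⟧-cong (C? y) (C? y ×-dec ¬? (m y ≟ y)) (λ c → c , y≢u ∘ only-u c) proj₁)
          (cong (_+ ⟦ C? y ×-dec ¬? (m y ≟ y) ⟧) (sym (⟦⟧-no (y ≟ u) y≢u)))

        split : ∀ y → ⟦ C? y ⟧ ≡ ⟦ y ≟ u ⟧ + valency Matched? y
        split y = trans (by-cases y (y ≟ u)) (cong (⟦ y ≟ u ⟧ +_) (sym (trans
          (∑-cong vs λ z → ⟦⟧-* (z ≟ m y) (C? y ×-dec ¬? (m y ≟ y)))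
          (∑-sift (λ _ → ⟦ C? y ×-dec ¬? (m y ≟ y) ⟧) (m y)))))

      inside-total : ∑[ y ∈ vs ] valency Inside? y ≡ k * ∑[ y ∈ vs ] ⟦ C? y ⟧
      inside-total = trans (∑-cong vs λ y → begin
        valency Inside? y                              ≡⟨ ∑-cong vs (λ z → ⟦⟧-* (C? y) (R? y z)) ⟩
        ∑[ z ∈ vs ] (⟦ C? y ⟧ * ⟦ R? y z ⟧)            ≡⟨ ∑-*ˡ ⟦ C? y ⟧ vs _ ⟩
        ⟦ C? y ⟧ * valency R? y                        ≡⟨ cong (⟦ C? y ⟧ *_) (regular y) ⟩
        ⟦ C? y ⟧ * k                                   ≡⟨ *-comm ⟦ C? y ⟧ k ⟩
        k * ⟦ C? y ⟧                                   ∎) (∑-*ˡ k vs _)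

      even-order : 2 ∣ ∑[ y ∈ vs ] ⟦ C? y ⟧
      even-order = [ (λ even → contradiction even odd) , id ]′ (euclidsLemma k _ prime[2]
        (subst (2 ∣_) inside-total (total-valency-even Inside? (λ (c , yz) → c ◅◅ yz ◅ ε , R-sym yz) λ y → R-irrefl y ∘ proj₂)))

  -- Perfect matchings in vertex-transitive graphs of odd valency.

  private
    _[_↦_] : (X → X) → X → X → X → X
    (f [ x ↦ v ]) y = if does (y ≟ x) then v else f y

    -- Overwrites the identity at the entries of `l` in all ways; for `l = vs` this lists every
    -- function on `X` up to pointwise equality.
    functions : List X → List (X → X)
    functions [] = id ∷ []
    functions (x ∷ l) = concatMap (λ f → map (f [ x ↦_]) vs) (functions l)

    functions-complete : ∀ l (g : X → X) → ∃ λ (f : X → X) → f ∈ functions l × (∀ {y} → y ∈ l → f y ≡ g y)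
    functions-complete [] g = id , here refl , λ ()
    functions-complete (x ∷ l) g with functions-complete l g
    ... | f , f∈ , f≡g = f [ x ↦ g x ] ,
      ∈-concat⁺′ (∈-map⁺ (f [ x ↦_]) (vs-complete (g x))) (∈-map⁺ _ f∈) , agree
      where
      agree : ∀ {y} → y ∈ x ∷ l → (f [ x ↦ g x ]) y ≡ g y
      agree {y} y∈ with y ≟ x
      agree _ | yes refl = refl
      agree (here refl) | no x≢x = contradiction refl x≢x
      agree (there y∈l) | no _ = f≡g y∈l

  -- Exhaustive search. Its decision allows leaving the double negation under which a maximum
  -- matching is found.
  perfect-matching? : Dec (∃ (IsPerfectMatching R))
  perfect-matching? with Any.any? perfect? (functions vs)
    where
    perfect? : ∀ m → Dec (All (λ x → m (m x) ≡ x × R x (m x)) vs)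
    perfect? m = All.all? (λ x → m (m x) ≟ x ×-dec R? x (m x)) vs
  ... | yes found = let m , all = Any.satisfied found in yes (m , λ x → All.lookup all (vs-complete x))
  ... | no none = no λ (m , perfect) →
    let f , f∈ , f≡m′ = functions-complete vs m
        f≡m = λ y → f≡m′ (vs-complete y)
    in none (lose f∈ (All.tabulate λ {x} _ →
      trans (f≡m (f x)) (trans (cong m (f≡m x)) (proj₁ (perfect x))) ,
      subst (R x) (sym (f≡m x)) (proj₂ (perfect x))))

  ∑-permute : ∀ (π : Sym X) (f : X → ℕ) → ∑[ y ∈ vs ] f (Inverse.from π y) ≡ ∑ vs f
  ∑-permute π f = begin
    ∑[ y ∈ vs ] f (Inverse.from π y)                               ≡⟨ ∑-cong vs (λ y → ∑-sift f (Inverse.from π y)) ⟨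
    ∑[ y ∈ vs ] ∑[ x ∈ vs ] (⟦ x ≟ Inverse.from π y ⟧ * f x)       ≡⟨ ∑-swap vs vs _ ⟩
    ∑[ x ∈ vs ] ∑[ y ∈ vs ] (⟦ x ≟ Inverse.from π y ⟧ * f x)       ≡⟨ ∑-cong vs (λ x → ∑-cong vs λ y → cong (_* f x) (⟦⟧-cong (x ≟ Inverse.from π y) (y ≟ (x ^ π))
                                                                        (λ { refl → sym (Inverse.strictlyInverseˡ π y) }) (λ { refl → sym (Inverse.strictlyInverseʳ π x) }))) ⟩
    ∑[ x ∈ vs ] ∑[ y ∈ vs ] (⟦ y ≟ (x ^ π) ⟧ * f x)                ≡⟨ ∑-cong vs (λ x → ∑-sift (λ _ → f x) (x ^ π)) ⟩
    ∑ vs f                                                         ∎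
    where open ≡-Reasoning

  -- The conjugate of `m` by `π` fixes `x ^ π` exactly if `m` fixes `x`, so it leaves equally many
  -- vertices unmatched.
  conjugate-maximum : ∀ (π : Sym X) → (∀ {x y} → R x y → R (x ^ π) (y ^ π)) →
    ∀ {m} → IsMaximum m → IsMaximum (λ y → m (Inverse.from π y) ^ π)
  conjugate-maximum π automorphism {m} (matching , maximum) =
    (λ y → trans (cong (λ z → m z ^ π) (strictlyInverseʳ _)) (trans (cong (_^ π) (proj₁ (matching (from y)))) (strictlyInverseˡ y)) ,
      λ m′y≢y → subst (λ z → R z (m (from y) ^ π)) (strictlyInverseˡ y)
        (automorphism (proj₂ (matching (from y)) λ fixed → m′y≢y (trans (cong (_^ π) fixed) (strictlyInverseˡ y))))) ,
    λ n n-matching → ≤-trans (≤-reflexive same-unmatched) (maximum n n-matching)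
    where
    open Inverse π using (from; strictlyInverseˡ; strictlyInverseʳ)

    same-unmatched : unmatched (λ y → m (from y) ^ π) ≡ unmatched m
    same-unmatched = trans
      (∑-cong vs λ y → ⟦⟧-cong ((m (from y) ^ π) ≟ y) (m (from y) ≟ from y)
        (λ eq → trans (sym (strictlyInverseʳ _)) (cong from eq))
        (λ eq → trans (cong (_^ π) eq) (strictlyInverseˡ y)))
      (∑-permute π λ x → ⟦ m x ≟ x ⟧)

  transitive-perfect-matching :
    (∀ x y → ∃ λ (π : Sym X) → (∀ {a b} → R a b → R (a ^ π) (b ^ π)) × x ^ π ≡ y) →
    ∀ {k} → ¬ 2 ∣ k → (∀ x → valency R? x ≡ k) → ∃ (IsPerfectMatching R)
  transitive-perfect-matching transitive odd regular = decidable-stable perfect-matching? λ no-perfect →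
    -- The descent starts at `id`, the empty matching.
    ¬¬-minimum (IsMatching R) unmatched (id , λ x → refl , λ x≢x → contradiction refl x≢x) λ (m , max) →
    no-perfect (m , λ x → proj₁ (proj₁ max x) , proj₂ (proj₁ max x) (matched max x))
    where
    matched : ∀ {m} → IsMaximum m → ∀ u → m u ≢ u
    matched {m} max u mu≡u = odd-valency-matched avoidable odd regular max u mu≡u
      where
      avoidable : ∀ x → Avoidable x
      avoidable x with transitive u x
      ... | π , automorphism , refl = (λ y → m (Inverse.from π y) ^ π) , conjugate-maximum π automorphism max ,
        cong (_^ π) (trans (cong m (Inverse.strictlyInverseʳ π u)) mu≡u)

-- The classes of regular graphs in the theorem.

module FiniteGraph {X : Set} (x₀ : X) (G : SimpleDigraph X) (G-sym : IsSimpleGraph G)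
  (_≟_ : DecidableEquality X) (arc? : Decidable (Arc G))
  (vs : List X) (vs-unique : Unique vs) (vs-complete : ∀ x → x ∈ vs) where

  open FiniteSet _≟_ vs vs-unique vs-complete

  arc-irrefl : ∀ x → ¬ Arc G x x
  arc-irrefl x xx = loopless G xx refl

  regular-valency : ∀ {k} → RegularOfValency k G → ∀ x → valency arc? x ≡ k
  regular-valency regular x = HasSize⇒∑ (arc? x) (proj₁ (regular x))

  even-closed : ∀ {k} → RegularOfValency k G → 2 ∣ k → HasArc G → ClosedDAGraph G
  even-closed regular even has-arc =
    let πs , decomposes , closed = even-decomposition arc? G-sym arc-irrefl even (regular-valency regular)
    in closed-graph x₀ G G-sym arc? decomposes closed (_ , regular) has-arc

  odd-closed : ∀ {k} → RegularOfValency k G → ¬ 2 ∣ k → ∃ (IsPerfectMatching (Arc G)) → ClosedDAGraph G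
  odd-closed regular odd (m , perfect) =
    let πs , decomposes , closed = odd-decomposition arc? G-sym arc-irrefl odd (regular-valency regular) perfect
    in closed-graph x₀ G G-sym arc? decomposes closed (_ , regular) (x₀ , m x₀ , proj₂ (perfect x₀))

  bipartite-closed : Regular G → Bipartite G → HasArc G → ClosedDAGraph G
  bipartite-closed (k , regular) (part , proper) has-arc =
    let πs , decomposes , closed = bipartite-decomposition arc? G-sym part proper (regular-valency regular)
    in closed-graph x₀ G G-sym arc? decomposes closed (k , regular) has-arc

  -- The component of `x` contains `x` by the empty path, so `x` is an end of its single edge and
  -- the other end is its partner. A neighbour of `x` in `A′` lies in the component and differs from
  -- `x`; this uniqueness makes the partner map an involution.
  perfect-matching-function : HasPerfectMatching G → ∃ (IsPerfectMatching (Arc G))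
  perfect-matching-function (A′ , A′⇒Arc , A′-sym , single) =
    (λ x → proj₁ (partner x)) , λ x →
      sym (proj₂ (proj₂ (partner (proj₁ (partner x)))) (A′-sym (proj₁ (proj₂ (partner x))))) ,
      A′⇒Arc (proj₁ (proj₂ (partner x)))
    where
    partner : ∀ x → ∃ λ y → A′ x y × (∀ {z} → A′ x z → z ≡ y)
    partner x with single x
    ... | u , v , u≢v , (component⊆ , _) , _ , edge with component⊆ ε
    ... | inj₁ refl = v , proj₂ (proj₂ (edge (inj₁ (refl , refl)))) ,
      λ xz → [ (λ { refl → contradiction (A′⇒Arc xz) (arc-irrefl _) }) , id ]′ (component⊆ (xz ◅ ε))
    ... | inj₂ refl = u , proj₂ (proj₂ (edge (inj₂ (refl , refl)))) ,
      λ xz → [ id , (λ { refl → contradiction (A′⇒Arc xz) (arc-irrefl _) }) ]′ (component⊆ (xz ◅ ε))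

  -- An automorphism taking `x₀` to `x` carries the neighbours of `x₀` bijectively to those of `x`;
  -- symmetry of the arcs settles the in-neighbours.
  transitive⇒regular : VertexTransitive G → Regular G
  transitive⇒regular transitive = length neighbours , λ x →
    size x , let l , u , len , l⊆ , ⊆l = size x in l , u , len , G-sym ∘ l⊆ , ⊆l ∘ G-sym
    where
    neighbours : List X
    neighbours = filter (arc? x₀) vs

    size : ∀ x → HasSize (Arc G x) (length neighbours)
    size x with transitive x₀ x
    ... | π , (preserves , reflects) , refl =
      map (_^ π) neighbours , Unique.map⁺ injective (Unique.filter⁺ (arc? x₀) vs-unique) ,
      length-map (_^ π) neighbours , sound , complete
      where
      open Inverse π using (from; strictlyInverseˡ; strictlyInverseʳ)

      injective : ∀ {y z} → y ^ π ≡ z ^ π → y ≡ z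
      injective {y} {z} eq = trans (sym (strictlyInverseʳ y)) (trans (cong from eq) (strictlyInverseʳ z))

      sound : ∀ {z} → z ∈ map (_^ π) neighbours → Arc G (x₀ ^ π) z
      sound z∈ with ∈-map⁻ (_^ π) z∈
      ... | y , y∈ , refl = preserves (proj₂ (∈-filter⁻ (arc? x₀) {xs = vs} y∈))

      complete : ∀ {z} → Arc G (x₀ ^ π) z → z ∈ map (_^ π) neighbours
      complete {z} arc = subst (_∈ map (_^ π) neighbours) (strictlyInverseˡ z)
        (∈-map⁺ (_^ π) (∈-filter⁺ (arc? x₀) (vs-complete (from z))
          (reflects (subst (Arc G (x₀ ^ π)) (sym (strictlyInverseˡ z)) arc))))

  transitive-closed : VertexTransitive G → HasArc G → ClosedDAGraph G
  transitive-closed transitive has-arc with transitive⇒regular transitive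
  ... | k , regular with 2 ∣? k
  ... | yes even = even-closed regular even has-arc
  ... | no odd = odd-closed regular odd (transitive-perfect-matching
    (λ x y → let π , (preserves , _) , eq = transitive x y in π , preserves , eq) odd (regular-valency regular))
    where
    open Matchings _≟_ vs vs-unique vs-complete arc? G-sym arc-irrefl

theorem1p10 : (X : Set) (x₀ : X) (G : SimpleDigraph X) →
    IsSimpleGraph G → FiniteDigraph G →
    ((k : ℕ) → RegularOfValency k G → 2 ∣ k → HasArc G → ClosedDAGraph G)
    × ((k : ℕ) → RegularOfValency k G → ¬ (2 ∣ k) → HasPerfectMatching G → ClosedDAGraph G)
    × (VertexTransitive G → HasArc G → ClosedDAGraph G)
    × (Regular G → Bipartite G → HasArc G → ClosedDAGraph G)
theorem1p10 X x₀ G G-sym ((n , X↔Fin) , arc?) =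
  (λ k → even-closed) , (λ k regular odd matching → odd-closed regular odd (perfect-matching-function matching)) ,
  transitive-closed , bipartite-closed
  where
  open Inverse X↔Fin using (to; from; strictlyInverseˡ; strictlyInverseʳ)

  from-injective : ∀ {i j} → from i ≡ from j → i ≡ j
  from-injective {i} {j} eq = trans (sym (strictlyInverseˡ i)) (trans (cong to eq) (strictlyInverseˡ j))

  open FiniteGraph x₀ G G-sym (via-injection (↔⇒↣ X↔Fin) Fin._≟_) arc?
    (map from (allFin n)) (Unique.map⁺ from-injective (Unique.allFin⁺ n))
    (λ x → subst (_∈ map from (allFin n)) (strictlyInverseʳ x) (∈-map⁺ from (∈-allFin (to x))))
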